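{- Let $\Gamma\cup\{\varphi\}$ be a finite set of closed formulas over a basic predicate signature $\Theta$. If $\Gamma\models_{\mathbf{Tm}^*}\varphi$ then $\Gamma\models_{\mathcal T(\mathbf{Tm}^*)}\varphi$.
   Context: Syntax. A basic predicate signature $\Theta$ consists of a nonempty set of predicate symbols, each of arity $\geq1$, and a possibly empty set $C$ of constants (no function symbols, no equality). Terms are variables or constants; formulas: atomic $P\tau_1\ldots\tau_n$, and $\neg\varphi$, $\Box\varphi$, $\forall x\varphi$, $\varphi\to\psi$. $\exists x\varphi$ abbreviates $\neg\forall x\neg\varphi$. $\varphi[x/\tau]$ is substitution of free occurrences of $x$ by $\tau$. Variants $\varphi\sim\psi$: one is obtained from the other by adding/deleting void quantifiers or by renaming bound variables (keeping free variables in the same places). Semantics. Truth values $\{\mathsf T,\mathsf t,\mathsf f,\mathsf F\}$, designated $\{\mathsf T,\mathsf t\}$. $\tilde\neg$: $\mathsf T\mapsto\{\mathsf F\},\mathsf t\mapsto\{\mathsf f\},\mathsf f\mapsto\{\mathsf t\},\mathsf F\mapsto\{\mathsf T\}$. $a\tilde\to b$ (rows $a$, columns $b$ in order $\mathsf T,\mathsf t,\mathsf f,\mathsf F$): row $\mathsf T$: $\{\mathsf T\},\{\mathsf t\},\{\mathsf f\},\{\mathsf F\}$; row $\mathsf t$: $\{\mathsf T\},\{\mathsf T,\mathsf t\},\{\mathsf f\},\{\mathsf f\}$; row $\mathsf f$: $\{\mathsf T\},\{\mathsf T,\mathsf t\},\{\mathsf T,\mathsf t\},\{\mathsf t\}$;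 row $\mathsf F$: all $\{\mathsf T\}$. $\tilde\Box_1\mathsf T=\{\mathsf T,\mathsf t\}$, $\tilde\Box_1a=\{\mathsf f,\mathsf F\}$ for $a\ne\mathsf T$. $\tilde\forall^d_4(X)=\{\min X\}$ for nonempty $X$, order $\mathsf F<\mathsf f<\mathsf t<\mathsf T$. A structure $\mathfrak A=\langle U,\cdot^{\mathfrak A}\rangle$ over $\Theta$: $U\ne\emptyset$, $P^{\mathfrak A}:U^n\to\{\mathsf T,\mathsf t,\mathsf f,\mathsf F\}$, $c^{\mathfrak A}\in U$. $\Theta_U$ adds new constants $\bar a$ for $a\in U\setminus C^{\mathfrak A}$, interpreted by $a$ in $\mathfrak A_U$. A $\mathbf{Tm}^*$-valuation over $\mathfrak A$ is $v:Sen(\Theta_U)\to\{\mathsf T,\mathsf t,\mathsf f,\mathsf F\}$ with $v(Pc_1\ldots c_n)=P^{\mathfrak A}(c_1^{\mathfrak A_U},\ldots,c_n^{\mathfrak A_U})$, $v(\neg\varphi)\in\tilde\neg v(\varphi)$, $v(\Box\varphi)\in\tilde\Box_1v(\varphi)$, $v(\varphi\to\psi)\in v(\varphi)\tilde\to v(\psi)$, $v(\forall x\varphi)\in\tilde\forall^d_4(\{v(\varphi[x/c]):c\in C\cup\bar U\})$, and $v(\varphi)=v(\varphi')$ whenever $\varphi\sim\varphi'$. For formulas with free variables among $x_1,\dots,x_n$, $\Gamma\models_{\mathbf{Tm}^*}\varphi$ iff for every structure $\mathfrak A$ over $\Theta$ and every $\mathbf{Tm}^*$-valuation $v$ over it,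 if $v(\gamma[\vec x/\vec c])\in\{\mathsf T,\mathsf t\}$ for all $\gamma\in\Gamma$ and all $\vec c$ from $C\cup\bar U$, then $v(\varphi[\vec x/\vec c])\in\{\mathsf T,\mathsf t\}$ for all $\vec c$. Tableaux. Let $\bar C=\{c_1,c_2,\ldots\}$ be an infinite set of new constants, $\Theta(\bar C)$ the extended signature. A signed formula is $\mathsf L{:}\varphi$ with $\mathsf L\in\{\mathsf T,\mathsf t,\mathsf f,\mathsf F\}$, $\varphi$ closed over $\Theta(\bar C)$; $\varphi(c)$ means $\varphi[x/c]$. A tableau for a signed formula is a finite tree with that formula at the root, obtained by repeatedly applying a rule to a signed formula on a branch and extending that branch by the alternatives of the rule (separated by $\mid$; each alternative gives a new branch containing the listed signed formulas). Rules: $\mathsf T{:}\neg\varphi/\mathsf F{:}\varphi$; $\mathsf t{:}\neg\varphi/\mathsf f{:}\varphi$; $\mathsf f{:}\neg\varphi/\mathsf t{:}\varphi$; $\mathsf F{:}\neg\varphi/\mathsf T{:}\varphi$; $\mathsf T{:}\Box\varphi/\mathsf T{:}\varphi$; $\mathsf t{:}\Box\varphi/\mathsf T{:}\varphi$; $\mathsf f{:}\Box\varphi/\mathsf t{:}\varphi\mid\mathsf f{:}\varphi\mid\mathsf F{:}\varphi$; $\mathsf F{:}\Box\varphi/\mathsf t{:}\varphi\mid\mathsf f{:}\varphi\mid\mathsf F{:}\varphi$; $\mathsf T{:}(\varphi\to\psi)/\mathsf F{:}\varphi\mid\mathsf t{:}\varphi,\mathsf t{:}\psi\mid\mathsf f{:}\varphi,\mathsf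 t{:}\psi\mid\mathsf f{:}\varphi,\mathsf f{:}\psi\mid\mathsf T{:}\psi$; $\mathsf t{:}(\varphi\to\psi)/\mathsf T{:}\varphi,\mathsf t{:}\psi\mid\mathsf t{:}\varphi,\mathsf t{:}\psi\mid\mathsf f{:}\varphi,\mathsf t{:}\psi\mid\mathsf f{:}\varphi,\mathsf f{:}\psi$; $\mathsf f{:}(\varphi\to\psi)/\mathsf T{:}\varphi,\mathsf f{:}\psi\mid\mathsf t{:}\varphi,\mathsf f{:}\psi\mid\mathsf t{:}\varphi,\mathsf F{:}\psi$; $\mathsf F{:}(\varphi\to\psi)/\mathsf T{:}\varphi,\mathsf F{:}\psi$. Quantifier rules: $(\mathsf T\forall)$ $\mathsf T{:}\forall x\varphi/\mathsf T{:}\varphi(c)$, $c$ any constant, reusable with any constants; $(\mathsf F\forall)$ $\mathsf F{:}\forall x\varphi/\mathsf F{:}\varphi(c)$, $c$ a constant not yet on the branch, usable only once per branch; $(\mathsf t\forall)$ $\mathsf t{:}\forall x\varphi/\mathsf t{:}\varphi(c),\mathsf t{:}\varphi(c')\mid\mathsf t{:}\varphi(c),\mathsf T{:}\varphi(c')$, where $c$ is new on the branch and $c'\neq c$ arbitrary; it is reusable in the sense that afterwards each resulting branch may again be split into a branch with $\mathsf t{:}\varphi(c'')$ and a branch with $\mathsf T{:}\varphi(c''')$ for any $c'',c'''\neq c$; $(\mathsf f\forall)$ $\mathsf f{:}\forall x\varphi/\mathsf f{:}\varphi(c),\mathsf f{:}\varphi(c')\mid\mathsf f{:}\varphi(c),\mathsf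 T{:}\varphi(c')\mid\mathsf f{:}\varphi(c),\mathsf t{:}\varphi(c')$, $c$ new on the branch, $c'\neq c$; reusable in the sense that each resulting branch may be split again into three branches containing $\mathsf f{:}\varphi(c'')$, $\mathsf T{:}\varphi(c''')$, $\mathsf t{:}\varphi(c'''')$ respectively, for any constants different from $c$. A branch is closed if it contains $\mathsf L{:}\varphi$ and $\mathsf L'{:}\varphi'$ with $\varphi\sim\varphi'$ and $\mathsf L\ne\mathsf L'$; a tableau is closed if all its branches are closed. A closed formula $\varphi$ over $\Theta$ is provable, $\models_{\mathcal T(\mathbf{Tm}^*)}\varphi$, if for each $\mathsf L\in\{\mathsf F,\mathsf f\}$ there is a closed tableau starting from $\mathsf L{:}\varphi$. For $\Gamma=\{\gamma_1,\ldots,\gamma_n\}$, $\Gamma\models_{\mathcal T(\mathbf{Tm}^*)}\varphi$ means $\models_{\mathcal T(\mathbf{Tm}^*)}(\gamma_1\to(\gamma_2\to\cdots\to(\gamma_n\to\varphi)\cdots))$. -}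

module Defs where

open import Data.Empty using (⊥-elim)
open import Data.Irrelevant as Irrelevant using ([_])
open import Data.List using (List; []; _∷_; _++_; foldr)
import Data.List as List
open import Data.List.Membership.Propositional using (_∈_; _∉_)
open import Data.List.Relation.Unary.All using (All; []; _∷_)
open import Data.Nat using (ℕ; _≤_; _≥_; _≟_)
open import Data.Product using (∃; ∃-syntax; Σ-syntax; _×_; _,_)
open import Data.Refinement using (Refinement-syntax; _,_; value)
open import Data.Sum as Sum using (_⊎_; inj₁; inj₂)
open import Data.Vec using (Vec)
import Data.Vec as Vec
import Data.Vec.Membership.Propositional as Vec∈
open import Data.Vec.Relation.Unary.Any using (here; there)
open import Relation.Binary.PropositionalEquality using (_≡_; _≢_; refl; sym)
open import Relation.Nullary using (¬_; yes; no)

------------------------------------------------------------------------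
-- Syntax

record Signature : Set₁ where
  field
    Pred          : Set
    somePredicate : Pred
    arity         : Pred → ℕ
    arity≥1       : ∀ P → arity P ≥ 1
    Const         : Set

open Signature public

infixl 6 _⊕_

_⊕_ : Signature → Set → Signature
Θ ⊕ X = record
  { Pred = Pred Θ ; somePredicate = somePredicate Θ
  ; arity = arity Θ ; arity≥1 = arity≥1 Θ
  ; Const = Const Θ ⊎ X }

Var : Set
Var = ℕ

data Term (Θ : Signature) : Set where
  var : Var → Term Θ
  con : Const Θ → Term Θ

infixr 9 ¬̇_ □_
infixr 7 _→̇_

data Formula (Θ : Signature) : Set where
  atom : (P : Pred Θ) → Vec (Term Θ) (arity Θ P) → Formula Θ
  ¬̇_   : Formula Θ → Formula Θ
  □_   : Formula Θ → Formula Θ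
  ∀̇    : Var → Formula Θ → Formula Θ
  _→̇_  : Formula Θ → Formula Θ → Formula Θ

private variable
  Θ : Signature

infix 4 _FreeIn_ _OccursIn_

_FreeIn_ : Var → Formula Θ → Set
x FreeIn atom P τs = var x Vec∈.∈ τs
x FreeIn ¬̇ φ       = x FreeIn φ
x FreeIn □ φ       = x FreeIn φ
x FreeIn ∀̇ y φ     = x ≢ y × x FreeIn φ
x FreeIn φ →̇ ψ     = x FreeIn φ ⊎ x FreeIn ψ

-- Any occurrence counts: free, bound, or as the variable of a quantifier.
_OccursIn_ : Term Θ → Formula Θ → Set
τ OccursIn atom P τs = τ Vec∈.∈ τs
τ OccursIn ¬̇ φ       = τ OccursIn φ
τ OccursIn □ φ       = τ OccursIn φ
τ OccursIn ∀̇ y φ     = τ ≡ var y ⊎ τ OccursIn φ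
τ OccursIn φ →̇ ψ     = τ OccursIn φ ⊎ τ OccursIn ψ

Closed : Formula Θ → Set
Closed φ = ∀ x → ¬ (x FreeIn φ)

Substitution : Signature → Set
Substitution Θ = Var → Term Θ

_except_ : Substitution Θ → Var → Substitution Θ
(σ except y) z with y ≟ z
... | yes _ = var z
... | no  _ = σ z

_↦_ : Var → Term Θ → Substitution Θ
(x ↦ τ) z with x ≟ z
... | yes _ = τ
... | no  _ = var z

substTerm : Substitution Θ → Term Θ → Term Θ
substTerm σ (var x) = σ x
substTerm σ (con c) = con c

infix 10 _⟪_⟫ _[_/_]

-- Simultaneous substitution for the free occurrences.  Bound variables are not
-- renamed, so it is only meaningful when no capture occurs; below it is used
-- with constants and with variables not occurring in the formula.
_⟪_⟫ : Formula Θ → Substitution Θ → Formula Θ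
(atom P τs) ⟪ σ ⟫ = atom P (Vec.map (substTerm σ) τs)
(¬̇ φ)       ⟪ σ ⟫ = ¬̇ (φ ⟪ σ ⟫)
(□ φ)       ⟪ σ ⟫ = □ (φ ⟪ σ ⟫)
(∀̇ y φ)     ⟪ σ ⟫ = ∀̇ y (φ ⟪ σ except y ⟫)
(φ →̇ ψ)     ⟪ σ ⟫ = (φ ⟪ σ ⟫) →̇ (ψ ⟪ σ ⟫)

_[_/_] : Formula Θ → Var → Term Θ → Formula Θ
φ [ x / τ ] = φ ⟪ x ↦ τ ⟫

infix 4 _∼_

-- Variants: the congruence generated by void quantifiers and renaming of bound
-- variables.  Renaming to a variable not occurring at all suffices, since any
-- other legitimate renaming is a composite of such steps.
data _∼_ {Θ : Signature} : Formula Θ → Formula Θ → Set where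
  ∼refl  : ∀ {φ} → φ ∼ φ
  ∼sym   : ∀ {φ ψ} → φ ∼ ψ → ψ ∼ φ
  ∼trans : ∀ {φ ψ χ} → φ ∼ ψ → ψ ∼ χ → φ ∼ χ
  ∼¬     : ∀ {φ φ′} → φ ∼ φ′ → ¬̇ φ ∼ ¬̇ φ′
  ∼□     : ∀ {φ φ′} → φ ∼ φ′ → □ φ ∼ □ φ′
  ∼∀     : ∀ {x φ φ′} → φ ∼ φ′ → ∀̇ x φ ∼ ∀̇ x φ′
  ∼→     : ∀ {φ φ′ ψ ψ′} → φ ∼ φ′ → ψ ∼ ψ′ → φ →̇ ψ ∼ φ′ →̇ ψ′
  void   : ∀ {x φ} → ¬ (x FreeIn φ) → ∀̇ x φ ∼ φ
  rename : ∀ {x y φ} → ¬ (var y OccursIn φ) → ∀̇ x φ ∼ ∀̇ y (φ [ x / var y ])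

liftTerm : ∀ {X} → Term Θ → Term (Θ ⊕ X)
liftTerm (var x) = var x
liftTerm (con c) = con (inj₁ c)

lift : ∀ {X} → Formula Θ → Formula (Θ ⊕ X)
lift (atom P τs) = atom P (Vec.map liftTerm τs)
lift (¬̇ φ)       = ¬̇ lift φ
lift (□ φ)       = □ lift φ
lift (∀̇ x φ)     = ∀̇ x (lift φ)
lift (φ →̇ ψ)     = lift φ →̇ lift ψ

------------------------------------------------------------------------
-- Sentences

-- Closedness is irrelevant, so sentences are equal as soon as their formulas are.
Sentence : Signature → Set
Sentence Θ = [ φ ∈ Formula Θ ∣ Closed φ ]

private
  free-map : ∀ {A : Set} {n x} (f : A → Term Θ) (τs : Vec A n) →
             var x Vec∈.∈ Vec.map f τs → ∃[ τ ] τ Vec∈.∈ τs × f τ ≡ var x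
  free-map f (τ Vec.∷ τs) (here eq) = τ , here refl , sym eq
  free-map f (τ Vec.∷ τs) (there i) with free-map f τs i
  ... | τ′ , j , eq = τ′ , there j , eq

  free-⟪⟫ : ∀ (φ : Formula Θ) {σ x} → x FreeIn φ ⟪ σ ⟫ →
            ∃[ y ] y FreeIn φ × σ y ≡ var x
  free-⟪⟫ (atom P τs) {σ} i with free-map (substTerm σ) τs i
  ... | var y , j , eq = y , j , eq
  ... | con c , j , ()
  free-⟪⟫ (¬̇ φ) i = free-⟪⟫ φ i
  free-⟪⟫ (□ φ) i = free-⟪⟫ φ i
  free-⟪⟫ (∀̇ z φ) (x≢z , i) with free-⟪⟫ φ i
  ... | y , j , eq with z ≟ y
  free-⟪⟫ (∀̇ z φ) (x≢z , i) | y , j , refl | yes z≡y = ⊥-elim (x≢z (sym z≡y))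
  free-⟪⟫ (∀̇ z φ) (x≢z , i) | y , j , eq   | no z≢y  = y , ((λ y≡z → z≢y (sym y≡z)) , j) , eq
  free-⟪⟫ (φ →̇ ψ) (inj₁ i) with free-⟪⟫ φ i
  ... | y , j , eq = y , inj₁ j , eq
  free-⟪⟫ (φ →̇ ψ) (inj₂ i) with free-⟪⟫ ψ i
  ... | y , j , eq = y , inj₂ j , eq

  free-lift : ∀ {X} (φ : Formula Θ) {x} → x FreeIn lift {X = X} φ → x FreeIn φ
  free-lift (atom P τs) i with free-map liftTerm τs i
  ... | var y , j , refl = j
  ... | con c , j , ()
  free-lift (¬̇ φ)   i          = free-lift φ i
  free-lift (□ φ)   i          = free-lift φ i
  free-lift (∀̇ y φ) (x≢y , i)  = x≢y , free-lift φ i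
  free-lift (φ →̇ ψ) (inj₁ i)   = inj₁ (free-lift φ i)
  free-lift (φ →̇ ψ) (inj₂ i)   = inj₂ (free-lift ψ i)

  closed-atom : ∀ (P : Pred Θ) (cs : Vec (Const Θ) (arity Θ P)) →
                Closed {Θ} (atom P (Vec.map con cs))
  closed-atom P cs x i with free-map con cs i
  ... | c , j , ()

  closed-inst : ∀ x (φ : Formula Θ) → Closed (∀̇ x φ) → ∀ c → Closed (φ [ x / con c ])
  closed-inst x φ p c z i with free-⟪⟫ φ i
  ... | y , j , eq with x ≟ y
  closed-inst x φ p c z i | y , j , ()   | yes _
  closed-inst x φ p c z i | y , j , refl | no x≢y = p y ((λ y≡x → x≢y (sym y≡x)) , j)

  closed-close : ∀ (φ : Formula Θ) (ρ : Var → Const Θ) → Closed (φ ⟪ (λ x → con (ρ x)) ⟫)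
  closed-close φ ρ x i with free-⟪⟫ φ i
  ... | y , j , ()

infixr 9 ¬ˢ_ □ˢ_
infixr 7 _→ˢ_

atomˢ : (P : Pred Θ) → Vec (Const Θ) (arity Θ P) → Sentence Θ
atomˢ P cs = atom P (Vec.map con cs) , [ closed-atom P cs ]

¬ˢ_ : Sentence Θ → Sentence Θ
¬ˢ (φ , p) = ¬̇ φ , p

□ˢ_ : Sentence Θ → Sentence Θ
□ˢ (φ , p) = □ φ , p

_→ˢ_ : Sentence Θ → Sentence Θ → Sentence Θ
(φ , p) →ˢ (ψ , q) = φ →̇ ψ , Irrelevant.zipWith (λ p q x → Sum.[ p x , q x ]) p q

∀ˢ : ∀ x (φ : Formula Θ) → .(Closed (∀̇ x φ)) → Sentence Θ
∀ˢ x φ p = ∀̇ x φ , [ p ]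

inst : ∀ x (φ : Formula Θ) → .(Closed (∀̇ x φ)) → Const Θ → Sentence Θ
inst x φ p c = φ [ x / con c ] , [ closed-inst x φ p c ]

close : (Var → Const Θ) → Formula Θ → Sentence Θ
close ρ φ = φ ⟪ (λ x → con (ρ x)) ⟫ , [ closed-close φ ρ ]

liftˢ : ∀ {X} → Sentence Θ → Sentence (Θ ⊕ X)
liftˢ (φ , p) = lift φ , Irrelevant.map (λ p x i → p x (free-lift φ i)) p

------------------------------------------------------------------------
-- The nondeterministic matrix

data TV : Set where
  𝐓 𝐭 𝐟 𝐅 : TV

Designated : TV → Set
Designated a = a ∈ 𝐓 ∷ 𝐭 ∷ []

¬̃ : TV → List TV
¬̃ 𝐓 = 𝐅 ∷ []
¬̃ 𝐭 = 𝐟 ∷ []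
¬̃ 𝐟 = 𝐭 ∷ []
¬̃ 𝐅 = 𝐓 ∷ []

□̃₁ : TV → List TV
□̃₁ 𝐓 = 𝐓 ∷ 𝐭 ∷ []
□̃₁ _ = 𝐟 ∷ 𝐅 ∷ []

infixr 7 _→̃_

_→̃_ : TV → TV → List TV
𝐓 →̃ b = b ∷ []
𝐭 →̃ 𝐓 = 𝐓 ∷ []
𝐭 →̃ 𝐭 = 𝐓 ∷ 𝐭 ∷ []
𝐭 →̃ 𝐟 = 𝐟 ∷ []
𝐭 →̃ 𝐅 = 𝐟 ∷ []
𝐟 →̃ 𝐓 = 𝐓 ∷ []
𝐟 →̃ 𝐭 = 𝐓 ∷ 𝐭 ∷ []
𝐟 →̃ 𝐟 = 𝐓 ∷ 𝐭 ∷ []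
𝐟 →̃ 𝐅 = 𝐭 ∷ []
𝐅 →̃ b = 𝐓 ∷ []

rank : TV → ℕ
rank 𝐅 = 0
rank 𝐟 = 1
rank 𝐭 = 2
rank 𝐓 = 3

-- a ∈ {min X}
∀̃ᵈ₄ : (TV → Set) → TV → Set
∀̃ᵈ₄ X a = X a × (∀ b → X b → rank a ≤ rank b)

------------------------------------------------------------------------
-- Structures, valuations, consequence

record Structure (Θ : Signature) : Set₁ where
  field
    Universe    : Set
    someElement : Universe
    ⟦_⟧ᵖ        : (P : Pred Θ) → Vec Universe (arity Θ P) → TV
    ⟦_⟧ᶜ        : Const Θ → Universe

-- The constants ā, for a ∈ U ∖ C^𝔄.
NewConst : Structure Θ → Set
NewConst 𝔄 = [ a ∈ Universe ∣ ¬ (∃ λ c → ⟦ c ⟧ᶜ ≡ a) ]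
  where open Structure 𝔄

_⊕U_ : (Θ : Signature) → Structure Θ → Signature
Θ ⊕U 𝔄 = Θ ⊕ NewConst 𝔄

interpret : (𝔄 : Structure Θ) → Const (Θ ⊕U 𝔄) → Structure.Universe 𝔄
interpret 𝔄 (inj₁ c) = Structure.⟦ 𝔄 ⟧ᶜ c
interpret 𝔄 (inj₂ a) = value a

record IsTm*Valuation {Θ : Signature} (𝔄 : Structure Θ)
                      (v : Sentence (Θ ⊕U 𝔄) → TV) : Set where
  open Structure 𝔄
  field
    v-atom    : ∀ P cs → v (atomˢ P cs) ≡ ⟦ P ⟧ᵖ (Vec.map (interpret 𝔄) cs)
    v-¬       : ∀ φ → v (¬ˢ φ) ∈ ¬̃ (v φ)
    v-□       : ∀ φ → v (□ˢ φ) ∈ □̃₁ (v φ)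
    v-→       : ∀ φ ψ → v (φ →ˢ ψ) ∈ v φ →̃ v ψ
    v-∀       : ∀ x φ .(p : Closed (∀̇ x φ)) →
                ∀̃ᵈ₄ (λ a → ∃[ c ] v (inst x φ p c) ≡ a) (v (∀ˢ x φ p))
    v-variant : ∀ φ φ′ → value φ ∼ value φ′ → v φ ≡ v φ′

infix 3 _⊨Tm*_

-- A tuple of constants for the free variables is given as an assignment of a
-- constant to every variable.
_⊨Tm*_ : List (Formula Θ) → Formula Θ → Set₁
_⊨Tm*_ {Θ} Γ φ =
  (𝔄 : Structure Θ) (v : Sentence (Θ ⊕U 𝔄) → TV) → IsTm*Valuation 𝔄 v →
  (∀ γ → γ ∈ Γ → ∀ (ρ : Var → Const (Θ ⊕U 𝔄)) → Designated (v (close ρ (lift γ)))) →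
  ∀ (ρ : Var → Const (Θ ⊕U 𝔄)) → Designated (v (close ρ (lift φ)))

------------------------------------------------------------------------
-- Tableaux

infix 6 _∶_

record Signed (Θ : Signature) : Set where
  constructor _∶_
  field
    sign     : TV
    sentence : Sentence Θ

open Signed public

infix 4 _⟶_

-- The propositional and modal rules; each inner list is one alternative.
data _⟶_ {Θ : Signature} : Signed Θ → List (List (Signed Θ)) → Set where
  T¬ : ∀ {φ} → 𝐓 ∶ ¬ˢ φ ⟶ (𝐅 ∶ φ ∷ []) ∷ []
  t¬ : ∀ {φ} → 𝐭 ∶ ¬ˢ φ ⟶ (𝐟 ∶ φ ∷ []) ∷ []
  f¬ : ∀ {φ} → 𝐟 ∶ ¬ˢ φ ⟶ (𝐭 ∶ φ ∷ []) ∷ []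
  F¬ : ∀ {φ} → 𝐅 ∶ ¬ˢ φ ⟶ (𝐓 ∶ φ ∷ []) ∷ []
  T□ : ∀ {φ} → 𝐓 ∶ □ˢ φ ⟶ (𝐓 ∶ φ ∷ []) ∷ []
  t□ : ∀ {φ} → 𝐭 ∶ □ˢ φ ⟶ (𝐓 ∶ φ ∷ []) ∷ []
  f□ : ∀ {φ} → 𝐟 ∶ □ˢ φ ⟶ (𝐭 ∶ φ ∷ []) ∷ (𝐟 ∶ φ ∷ []) ∷ (𝐅 ∶ φ ∷ []) ∷ []
  F□ : ∀ {φ} → 𝐅 ∶ □ˢ φ ⟶ (𝐭 ∶ φ ∷ []) ∷ (𝐟 ∶ φ ∷ []) ∷ (𝐅 ∶ φ ∷ []) ∷ []
  T→ : ∀ {φ ψ} → 𝐓 ∶ (φ →ˢ ψ) ⟶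
         (𝐅 ∶ φ ∷ []) ∷
         (𝐭 ∶ φ ∷ 𝐭 ∶ ψ ∷ []) ∷
         (𝐟 ∶ φ ∷ 𝐭 ∶ ψ ∷ []) ∷
         (𝐟 ∶ φ ∷ 𝐟 ∶ ψ ∷ []) ∷
         (𝐓 ∶ ψ ∷ []) ∷ []
  t→ : ∀ {φ ψ} → 𝐭 ∶ (φ →ˢ ψ) ⟶
         (𝐓 ∶ φ ∷ 𝐭 ∶ ψ ∷ []) ∷
         (𝐭 ∶ φ ∷ 𝐭 ∶ ψ ∷ []) ∷
         (𝐟 ∶ φ ∷ 𝐭 ∶ ψ ∷ []) ∷
         (𝐟 ∶ φ ∷ 𝐟 ∶ ψ ∷ []) ∷ []
  f→ : ∀ {φ ψ} → 𝐟 ∶ (φ →ˢ ψ) ⟶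
         (𝐓 ∶ φ ∷ 𝐟 ∶ ψ ∷ []) ∷
         (𝐭 ∶ φ ∷ 𝐟 ∶ ψ ∷ []) ∷
         (𝐭 ∶ φ ∷ 𝐅 ∶ ψ ∷ []) ∷ []
  F→ : ∀ {φ ψ} → 𝐅 ∶ (φ →ˢ ψ) ⟶
         (𝐓 ∶ φ ∷ 𝐅 ∶ ψ ∷ []) ∷ []

-- `formulas` are the signed formulas from the node up to the root.  A pair
-- (s , c) in `witnesses` records that F∀, t∀ or f∀ has been applied to s on
-- this branch with new constant c; it is what makes "only once per branch" and
-- the constraint "≠ c" on later reuse expressible.
record Branch (Θ : Signature) : Set where
  constructor branch
  field
    formulas  : List (Signed Θ)
    witnesses : List (Signed Θ × Const Θ)

open Branch public

root : Signed Θ → Branch Θ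
root s = branch (s ∷ []) []

infixl 5 _▸_ _▸_witness_

_▸_ : Branch Θ → List (Signed Θ) → Branch Θ
B ▸ ss = branch (ss ++ formulas B) (witnesses B)

_▸_witness_ : Branch Θ → List (Signed Θ) → Signed Θ × Const Θ → Branch Θ
B ▸ ss witness w = branch (ss ++ formulas B) (w ∷ witnesses B)

NewOn : Const Θ → Branch Θ → Set
NewOn c B = ∀ s → s ∈ formulas B → ¬ (con c OccursIn value (sentence s))

Unwitnessed : Signed Θ → Branch Θ → Set
Unwitnessed s B = ∀ c → (s , c) ∉ witnesses B

-- Step B Bs: some rule applied on branch B replaces it by the branches Bs.
data Step {Θ : Signature} (B : Branch Θ) : List (Branch Θ) → Set where

  prop : ∀ {s alts} → s ∈ formulas B → s ⟶ alts → Step B (List.map (B ▸_) alts)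

  T∀ : ∀ {x φ} .{p : Closed (∀̇ x φ)} → 𝐓 ∶ ∀ˢ x φ p ∈ formulas B →
       ∀ c → Step B ((B ▸ (𝐓 ∶ inst x φ p c ∷ [])) ∷ [])

  F∀ : ∀ {x φ} .{p : Closed (∀̇ x φ)} → let s = 𝐅 ∶ ∀ˢ x φ p in
       s ∈ formulas B → Unwitnessed s B →
       ∀ c → NewOn c B → Step B ((B ▸ (𝐅 ∶ inst x φ p c ∷ []) witness (s , c)) ∷ [])

  t∀ : ∀ {x φ} .{p : Closed (∀̇ x φ)} → let s = 𝐭 ∶ ∀ˢ x φ p ; φ⟨_⟩ = inst x φ p in
       s ∈ formulas B → Unwitnessed s B →
       ∀ c c′ → NewOn c B → c′ ≢ c →
       Step B ( (B ▸ (𝐭 ∶ φ⟨ c ⟩ ∷ 𝐭 ∶ φ⟨ c′ ⟩ ∷ []) witness (s , c))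
              ∷ (B ▸ (𝐭 ∶ φ⟨ c ⟩ ∷ 𝐓 ∶ φ⟨ c′ ⟩ ∷ []) witness (s , c))
              ∷ [])

  t∀-again : ∀ {x φ} .{p : Closed (∀̇ x φ)} → let s = 𝐭 ∶ ∀ˢ x φ p ; φ⟨_⟩ = inst x φ p in
       ∀ {c} → (s , c) ∈ witnesses B →
       ∀ c₁ c₂ → c₁ ≢ c → c₂ ≢ c →
       Step B ( (B ▸ (𝐭 ∶ φ⟨ c₁ ⟩ ∷ []))
              ∷ (B ▸ (𝐓 ∶ φ⟨ c₂ ⟩ ∷ []))
              ∷ [])

  f∀ : ∀ {x φ} .{p : Closed (∀̇ x φ)} → let s = 𝐟 ∶ ∀ˢ x φ p ; φ⟨_⟩ = inst x φ p in
       s ∈ formulas B → Unwitnessed s B →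
       ∀ c c′ → NewOn c B → c′ ≢ c →
       Step B ( (B ▸ (𝐟 ∶ φ⟨ c ⟩ ∷ 𝐟 ∶ φ⟨ c′ ⟩ ∷ []) witness (s , c))
              ∷ (B ▸ (𝐟 ∶ φ⟨ c ⟩ ∷ 𝐓 ∶ φ⟨ c′ ⟩ ∷ []) witness (s , c))
              ∷ (B ▸ (𝐟 ∶ φ⟨ c ⟩ ∷ 𝐭 ∶ φ⟨ c′ ⟩ ∷ []) witness (s , c))
              ∷ [])

  f∀-again : ∀ {x φ} .{p : Closed (∀̇ x φ)} → let s = 𝐟 ∶ ∀ˢ x φ p ; φ⟨_⟩ = inst x φ p in
       ∀ {c} → (s , c) ∈ witnesses B →
       ∀ c₁ c₂ c₃ → c₁ ≢ c → c₂ ≢ c → c₃ ≢ c →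
       Step B ( (B ▸ (𝐟 ∶ φ⟨ c₁ ⟩ ∷ []))
              ∷ (B ▸ (𝐓 ∶ φ⟨ c₂ ⟩ ∷ []))
              ∷ (B ▸ (𝐭 ∶ φ⟨ c₃ ⟩ ∷ []))
              ∷ [])

-- Tableau B: what grows below a node whose branch up to the root is B.
data Tableau {Θ : Signature} (B : Branch Θ) : Set where
  leaf : Tableau B
  node : ∀ {Bs} → Step B Bs → All Tableau Bs → Tableau B

mutual
  branches : {B : Branch Θ} → Tableau B → List (Branch Θ)
  branches {B = B} leaf = B ∷ []
  branches (node _ ts)  = branchesAll ts

  branchesAll : {Bs : List (Branch Θ)} → All Tableau Bs → List (Branch Θ)
  branchesAll []       = []
  branchesAll (t ∷ ts) = branches t ++ branchesAll ts

ClosedBranch : Branch Θ → Set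
ClosedBranch B =
  ∃[ s ] ∃[ s′ ] s ∈ formulas B × s′ ∈ formulas B ×
    value (sentence s) ∼ value (sentence s′) × sign s ≢ sign s′

ClosedTableau : {B : Branch Θ} → Tableau B → Set
ClosedTableau t = All ClosedBranch (branches t)

-- The new constants C̄ = {c₁, c₂, …} are the elements of ℕ.
Provable : Sentence Θ → Set
Provable {Θ} φ =
  ∀ L → L ∈ 𝐅 ∷ 𝐟 ∷ [] → Σ[ t ∈ Tableau {Θ ⊕ ℕ} (root (L ∶ liftˢ φ)) ] ClosedTableau t

infix 3 _⊨𝒯Tm*_

_⊨𝒯Tm*_ : List (Sentence Θ) → Sentence Θ → Set
Γ ⊨𝒯Tm* φ = Provable (foldr _→ˢ_ φ Γ)

{-# OPTIONS --safe #-}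

-- A branch that no tableau below it closes can be prolonged, by every rule, to
-- another such branch.  Doing this fairly yields a Hintikka set H of signed
-- sentences, in which variants carry the same sign.  A sentence is valued by its
-- sign in H if a variant of it occurs there, and otherwise by any value that the
-- truth tables admit for the values of its constituents.  For this to respect
-- variants the recursion runs over normal forms modulo ∼: trees without void
-- quantifiers and branching over the universe instead of binding variables.
-- That equal normal forms come from variants, so that H is single-valued on
-- normal forms, is seen by reading a formula back from its tree, with new
-- constants standing for bound variables.
module Submission where

open import Axiom.ExcludedMiddle using (ExcludedMiddle)
open import Data.Empty using (⊥-elim; ⊥-elim-irr)
open import Data.Irrelevant using ([_])
open import Data.List using (List; []; _∷_; _++_; cartesianProduct; concatMap; foldr; map; upTo)
open import Data.List.Membership.Propositional using (_∈_; find; lose)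
import Data.List.Membership.Propositional.Properties as List∈
open import Data.List.Membership.Propositional.Properties
  using (∈-++⁺ˡ; ∈-++⁺ʳ; ∈-++⁻; ∈-cartesianProduct⁺; ∈-cartesianProduct⁻; ∈-upTo⁺)
open import Data.List.Relation.Binary.Subset.Propositional using (_⊆_)
open import Data.List.Relation.Unary.All as All using (All; []; _∷_)
open import Data.List.Relation.Unary.All.Properties using (++⁺; ¬All⇒Any¬)
open import Data.List.Relation.Unary.Any as Any using (Any; here; there)
import Data.List.Relation.Unary.Any.Properties as Anyₚ
open import Data.Nat using (ℕ; zero; suc; _+_; _∸_; _≤_; _<_; _≟_; _≤?_; z≤n; s≤s)
open import Data.Nat.Properties
open import Data.Product using (∃; ∃-syntax; Σ-syntax; _×_; _,_; proj₁; proj₂)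
open import Data.Refinement using (value; _,_; value-injective)
open import Data.Sum as Sum using (_⊎_; inj₁; inj₂; [_,_]′)
open import Data.Vec using (Vec; []; _∷_)
import Data.Vec as Vec
import Data.Vec.Membership.Propositional as Vec∈
import Data.Vec.Membership.Propositional.Properties as Vec∈
import Data.Vec.Properties as Vec
open import Data.Vec.Relation.Unary.Any using (here; there)
import Data.Vec.Relation.Unary.Any as VecAny
import Data.Vec.Relation.Unary.Any.Properties as VecAnyₚ
open import Function using (_∘_; id)
open import Level using (0ℓ)
open import Relation.Binary.PropositionalEquality hiding ([_])
open import Relation.Nullary using (¬_; Dec; yes; no; ¬?; _×-dec_; _⊎-dec_)
open import Defs

-- A sign `L` on `∀̇ x φ` says that `L` is the least value among the instances. The quantifier rules
-- supply this in two halves: a recorded witness, or for `𝐓` any instance, attains `L`; and for `𝐓`,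
-- `𝐭` and `𝐟` every alternative signs the other instance with a value of rank at least that of `L`,
-- so whichever branch stays open, the bound holds there.
--
-- The stages of the construction are countable, the constants of `Θ` need not be. Hence everything
-- is seen through an idempotent map `r` that fixes the new constants and those of the root sentence
-- and sends all others to one new constant; conditions on instances are required only at constants
-- `r k`.
--
-- A Hintikka set does not sign every constituent: `𝐓 ∶ (φ →ˢ ψ)` may be expanded by `𝐓 ∶ ψ` alone.
-- Default values are therefore unavoidable, and the truth tables have to be checked for signed
-- compounds whose constituents have default values.
--
-- A signed sentence may also begin with void quantifiers that its normal form no longer shows;
-- these are removed by passing to a witnessing instance, which has the same sign and the same
-- normal form.

private variable
  Θ : Signature
  A A′ X K : Set

-- Substitution

-- Closedness is a negation, so an irrelevant proof of it is still usable: it only ever has to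
-- produce `⊥`.
recompute-closed : (φ : Formula Θ) → .(Closed φ) → Closed φ
recompute-closed φ p x i = ⊥-elim-irr (p x i)

private
  ∈-map⁻ : ∀ {n} (f : A → A′) (τs : Vec A n) {τ} → τ Vec∈.∈ Vec.map f τs →
           ∃[ τ′ ] τ′ Vec∈.∈ τs × τ ≡ f τ′
  ∈-map⁻ f τs i = Vec∈.find (VecAnyₚ.map⁻ i)

  map-cong-∈ : ∀ {n} {f g : A → A′} (τs : Vec A n) →
               (∀ τ → τ Vec∈.∈ τs → f τ ≡ g τ) → Vec.map f τs ≡ Vec.map g τs
  map-cong-∈ []       h = refl
  map-cong-∈ (τ ∷ τs) h = cong₂ _∷_ (h τ (here refl)) (map-cong-∈ τs λ τ i → h τ (there i))

except-same : (σ : Substitution Θ) → ∀ x → (σ except x) x ≡ var x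
except-same σ x with x ≟ x
... | yes _  = refl
... | no x≢x = ⊥-elim (x≢x refl)

except-other : (σ : Substitution Θ) → ∀ {x y} → x ≢ y → (σ except x) y ≡ σ y
except-other σ {x} {y} x≢y with x ≟ y
... | yes x≡y = ⊥-elim (x≢y x≡y)
... | no _    = refl

↦-same : ∀ x (τ : Term Θ) → (x ↦ τ) x ≡ τ
↦-same x τ with x ≟ x
... | yes _  = refl
... | no x≢x = ⊥-elim (x≢x refl)

↦-other : ∀ {x y} (τ : Term Θ) → x ≢ y → (x ↦ τ) y ≡ var y
↦-other {x = x} {y} τ x≢y with x ≟ y
... | yes x≡y = ⊥-elim (x≢y x≡y)
... | no _    = refl

substTerm-other : ∀ {x} (τ τ′ : Term Θ) → τ′ ≢ var x → substTerm (x ↦ τ) τ′ ≡ τ′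
substTerm-other τ (con c) τ′≢x = refl
substTerm-other τ (var y) τ′≢x = ↦-other τ λ { refl → τ′≢x refl }

subst-cong : ∀ (φ : Formula Θ) {σ σ′} → (∀ y → y FreeIn φ → σ y ≡ σ′ y) → φ ⟪ σ ⟫ ≡ φ ⟪ σ′ ⟫
subst-cong (atom P τs) {σ} {σ′} h = cong (atom P) (map-cong-∈ τs agree)
  where
  agree : ∀ τ → τ Vec∈.∈ τs → substTerm σ τ ≡ substTerm σ′ τ
  agree (var y) i = h y i
  agree (con c) i = refl
subst-cong (¬̇ φ)   h = cong ¬̇_ (subst-cong φ h)
subst-cong (□ φ)   h = cong □_ (subst-cong φ h)
subst-cong (∀̇ x φ) {σ} {σ′} h = cong (∀̇ x) (subst-cong φ agree)
  where
  agree : ∀ y → y FreeIn φ → (σ except x) y ≡ (σ′ except x) y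
  agree y i with x ≟ y
  ... | yes _  = refl
  ... | no x≢y = h y ((x≢y ∘ sym) , i)
subst-cong (φ →̇ ψ) h = cong₂ _→̇_ (subst-cong φ λ y → h y ∘ inj₁) (subst-cong ψ λ y → h y ∘ inj₂)

subst-id : ∀ (φ : Formula Θ) → φ ⟪ var ⟫ ≡ φ
subst-id (atom P τs) = cong (atom P) (trans (Vec.map-cong (λ { (var _) → refl ; (con _) → refl }) τs) (Vec.map-id τs))
subst-id (¬̇ φ)   = cong ¬̇_ (subst-id φ)
subst-id (□ φ)   = cong □_ (subst-id φ)
subst-id (∀̇ x φ) = cong (∀̇ x) (trans (subst-cong φ λ y _ → agree y) (subst-id φ))
  where
  agree : ∀ y → (var except x) y ≡ var y
  agree y with x ≟ y
  ... | yes refl = refl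
  ... | no _     = refl
subst-id (φ →̇ ψ) = cong₂ _→̇_ (subst-id φ) (subst-id ψ)

subst-closed : ∀ (φ : Formula Θ) {σ} → Closed φ → φ ⟪ σ ⟫ ≡ φ
subst-closed φ p = trans (subst-cong φ λ y i → ⊥-elim (p y i)) (subst-id φ)

-- Stronger than needed: φ's free variables are excluded as values too, which
-- the substitutions below satisfy.
CaptureFree : Substitution Θ → Formula Θ → Set
CaptureFree σ φ = ∀ y z → var z OccursIn φ → σ y ≡ var z → y ≡ z

captureFree-∀ : ∀ {σ : Substitution Θ} {x} {φ} → CaptureFree σ (∀̇ x φ) → CaptureFree (σ except x) φ
captureFree-∀ {x = x} h y z i eq with x ≟ y | eq
... | yes refl | refl = refl
... | no _     | eq   = h y z (inj₂ i) eq

captureFree-con : ∀ x c (φ : Formula Θ) → CaptureFree (x ↦ con c) φ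
captureFree-con x c φ y z i eq with x ≟ y | eq
... | yes _ | ()
... | no _  | refl = refl

captureFree-var : ∀ x y (φ : Formula Θ) → ¬ (var y OccursIn φ) → CaptureFree (x ↦ var y) φ
captureFree-var x y φ y∉φ w z i eq with x ≟ w | eq
... | yes _ | refl = ⊥-elim (y∉φ i)
... | no _  | refl = refl

subst-comp : ∀ (φ : Formula Θ) {σ τ} → CaptureFree σ φ →
             φ ⟪ σ ⟫ ⟪ τ ⟫ ≡ φ ⟪ substTerm τ ∘ σ ⟫
subst-comp (atom P τs) {σ} {τ} h =
  cong (atom P) (trans (sym (Vec.map-∘ _ _ τs)) (Vec.map-cong (λ { (var _) → refl ; (con _) → refl }) τs))
subst-comp (¬̇ φ)   h = cong ¬̇_ (subst-comp φ h)
subst-comp (□ φ)   h = cong □_ (subst-comp φ h)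
subst-comp (∀̇ x φ) {σ} {τ} h =
  cong (∀̇ x) (trans (subst-comp φ (captureFree-∀ {x = x} {φ} h)) (subst-cong φ λ y _ → agree y))
  where
  agree : ∀ y → substTerm (τ except x) ((σ except x) y) ≡ ((substTerm τ ∘ σ) except x) y
  agree y with x ≟ y
  ... | yes refl = except-same τ y
  ... | no x≢y with σ y in eq
  ...   | con c = refl
  -- Were `w` equal to `x`, the quantifier would capture it, which `CaptureFree` excludes.
  ...   | var w = except-other τ {x} {w} λ { refl → x≢y (sym (h y w (inj₁ refl) eq)) }
subst-comp (φ →̇ ψ) h = cong₂ _→̇_ (subst-comp φ λ y z → h y z ∘ inj₁) (subst-comp ψ λ y z → h y z ∘ inj₂)

-- Occurrences

free⇒occurs : ∀ (φ : Formula Θ) {x} → x FreeIn φ → var x OccursIn φ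
free⇒occurs (atom P τs) i        = i
free⇒occurs (¬̇ φ)       i        = free⇒occurs φ i
free⇒occurs (□ φ)       i        = free⇒occurs φ i
free⇒occurs (∀̇ y φ)     (_ , i)  = inj₂ (free⇒occurs φ i)
free⇒occurs (φ →̇ ψ)     (inj₁ i) = inj₁ (free⇒occurs φ i)
free⇒occurs (φ →̇ ψ)     (inj₂ i) = inj₂ (free⇒occurs ψ i)

free-subst⁻ : ∀ (φ : Formula Θ) {σ x} → x FreeIn φ ⟪ σ ⟫ → ∃[ y ] y FreeIn φ × σ y ≡ var x
free-subst⁻ (atom P τs) {σ} i with ∈-map⁻ (substTerm σ) τs i
... | var y , j , eq = y , j , sym eq
... | con c , j , ()
free-subst⁻ (¬̇ φ) i = free-subst⁻ φ i
free-subst⁻ (□ φ) i = free-subst⁻ φ i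
free-subst⁻ (∀̇ z φ) (x≢z , i) with free-subst⁻ φ i
... | y , j , eq with z ≟ y | eq
...   | yes refl | refl = ⊥-elim (x≢z refl)
...   | no z≢y   | eq′  = y , ((z≢y ∘ sym) , j) , eq′
free-subst⁻ (φ →̇ ψ) (inj₁ i) with free-subst⁻ φ i
... | y , j , eq = y , inj₁ j , eq
free-subst⁻ (φ →̇ ψ) (inj₂ i) with free-subst⁻ ψ i
... | y , j , eq = y , inj₂ j , eq

-- The last hypothesis prevents capture: a quantifier on `x` above the free occurrence of `y` would
-- be an occurrence of `x`, whence `x ≡ y`, although `y` is free below it.
free-subst⁺ : ∀ (φ : Formula Θ) {σ x y} → y FreeIn φ → σ y ≡ var x →
              (var x OccursIn φ → x ≡ y) → x FreeIn φ ⟪ σ ⟫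
free-subst⁺ (atom P τs) {σ} {x} {y} i eq h = subst (Vec∈._∈ Vec.map (substTerm σ) τs) eq (Vec∈.∈-map⁺ (substTerm σ) i)
free-subst⁺ (¬̇ φ) i eq h = free-subst⁺ φ i eq h
free-subst⁺ (□ φ) i eq h = free-subst⁺ φ i eq h
free-subst⁺ (∀̇ z φ) {σ} (y≢z , i) eq h =
  (λ { refl → y≢z (sym (h (inj₁ refl))) }) ,
  free-subst⁺ φ i (trans (except-other σ (y≢z ∘ sym)) eq) (h ∘ inj₂)
free-subst⁺ (φ →̇ ψ) (inj₁ i) eq h = inj₁ (free-subst⁺ φ i eq (h ∘ inj₁))
free-subst⁺ (φ →̇ ψ) (inj₂ i) eq h = inj₂ (free-subst⁺ ψ i eq (h ∘ inj₂))

occurs-subst : ∀ (φ : Formula Θ) {σ τ} → τ OccursIn φ ⟪ σ ⟫ → τ OccursIn φ ⊎ (∃[ y ] σ y ≡ τ)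
occurs-subst (atom P τs) {σ} i with ∈-map⁻ (substTerm σ) τs i
... | var y , j , eq   = inj₂ (y , sym eq)
... | con c , j , refl = inj₁ j
occurs-subst (¬̇ φ) i = occurs-subst φ i
occurs-subst (□ φ) i = occurs-subst φ i
occurs-subst (∀̇ x φ) (inj₁ eq) = inj₁ (inj₁ eq)
occurs-subst (∀̇ x φ) {σ} (inj₂ i) with occurs-subst φ i
... | inj₁ j = inj₁ (inj₂ j)
... | inj₂ (y , eq) with x ≟ y
...   | yes refl = inj₁ (inj₁ (sym eq))
...   | no _     = inj₂ (y , eq)
occurs-subst (φ →̇ ψ) (inj₁ i) = Sum.map₁ inj₁ (occurs-subst φ i)
occurs-subst (φ →̇ ψ) (inj₂ i) = Sum.map₁ inj₂ (occurs-subst ψ i)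

occurs-inst : ∀ x (φ : Formula Θ) c {k} → con k OccursIn φ [ x / con c ] → con k OccursIn φ ⊎ k ≡ c
occurs-inst x φ c i with occurs-subst φ i
... | inj₁ j = inj₁ j
... | inj₂ (y , eq) with x ≟ y | eq
...   | yes _ | refl = inj₂ refl
...   | no _  | ()

-- A crude upper bound for `w` on the terms that occur; its successor yields fresh variables and
-- fresh constants.
weight : (Term Θ → ℕ) → Formula Θ → ℕ
weight w (atom P τs) = Vec.sum (Vec.map w τs)
weight w (¬̇ φ)       = weight w φ
weight w (□ φ)       = weight w φ
weight w (∀̇ x φ)     = w (var x) + weight w φ
weight w (φ →̇ ψ)     = weight w φ + weight w ψ

occurs⇒≤weight : ∀ w (φ : Formula Θ) {τ} → τ OccursIn φ → w τ ≤ weight w φ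
occurs⇒≤weight w (atom P τs) i = ∈⇒≤sum τs i
  where
  ∈⇒≤sum : ∀ {n} (τs : Vec _ n) {τ} → τ Vec∈.∈ τs → w τ ≤ Vec.sum (Vec.map w τs)
  ∈⇒≤sum (_ ∷ _)  (here refl) = m≤m+n _ _
  ∈⇒≤sum (_ ∷ τs) (there i)   = ≤-trans (∈⇒≤sum τs i) (m≤n+m _ _)
occurs⇒≤weight w (¬̇ φ)   i           = occurs⇒≤weight w φ i
occurs⇒≤weight w (□ φ)   i           = occurs⇒≤weight w φ i
occurs⇒≤weight w (∀̇ x φ) (inj₁ refl) = m≤m+n _ _
occurs⇒≤weight w (∀̇ x φ) (inj₂ i)    = ≤-trans (occurs⇒≤weight w φ i) (m≤n+m _ _)
occurs⇒≤weight w (φ →̇ ψ) (inj₁ i)    = ≤-trans (occurs⇒≤weight w φ i) (m≤m+n _ _)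
occurs⇒≤weight w (φ →̇ ψ) (inj₂ i)    = ≤-trans (occurs⇒≤weight w ψ i) (m≤n+m _ _)

-- Reading the constants of such a formula through `r` loses nothing, so its normal form still
-- determines it up to variants.
FixedBy : (Const Θ → Const Θ) → Formula Θ → Set
FixedBy r φ = ∀ k → con k OccursIn φ → r k ≡ k

varIndex : Term Θ → ℕ
varIndex (var x) = x
varIndex (con _) = 0

newIndex : Term (Θ ⊕ ℕ) → ℕ
newIndex (con (inj₂ n)) = n
newIndex _              = 0

termConstants : Term Θ → List (Const Θ)
termConstants (var _) = []
termConstants (con c) = c ∷ []

constants : Formula Θ → List (Const Θ)
constants (atom P τs) = concatMap termConstants (Vec.toList τs)
constants (¬̇ φ)       = constants φ
constants (□ φ)       = constants φ
constants (∀̇ x φ)     = constants φ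
constants (φ →̇ ψ)     = constants φ ++ constants ψ

occurs⇒∈constants : ∀ (φ : Formula Θ) {c} → con c OccursIn φ → c ∈ constants φ
occurs⇒∈constants {Θ} (atom P τs) i = go τs i
  where
  go : ∀ {n} (τs : Vec (Term Θ) n) {c} → con c Vec∈.∈ τs → c ∈ concatMap termConstants (Vec.toList τs)
  go (_ ∷ _)  (here refl) = here refl
  go (τ ∷ τs) (there i)   = ∈-++⁺ʳ (termConstants τ) (go τs i)
occurs⇒∈constants (¬̇ φ)   i        = occurs⇒∈constants φ i
occurs⇒∈constants (□ φ)   i        = occurs⇒∈constants φ i
occurs⇒∈constants (∀̇ x φ) (inj₂ i) = occurs⇒∈constants φ i
occurs⇒∈constants (φ →̇ ψ) (inj₁ i) = ∈-++⁺ˡ (occurs⇒∈constants φ i)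
occurs⇒∈constants (φ →̇ ψ) (inj₂ i) = ∈-++⁺ʳ (constants φ) (occurs⇒∈constants ψ i)

free? : ∀ x (φ : Formula Θ) → Dec (x FreeIn φ)
free? {Θ} x (atom P τs) = VecAny.any? is-x? τs
  where
  is-x? : (τ : Term Θ) → Dec (var x ≡ τ)
  is-x? (con c) = no λ ()
  is-x? (var y) with x ≟ y
  ... | yes refl = yes refl
  ... | no x≢y   = no λ { refl → x≢y refl }
free? x (¬̇ φ)   = free? x φ
free? x (□ φ)   = free? x φ
free? x (∀̇ y φ) = ¬? (x ≟ y) ×-dec free? x φ
free? x (φ →̇ ψ) = free? x φ ⊎-dec free? x ψ

-- Makes the voidness test inside `tree` give the same answer on variants.
∼-free : {φ ψ : Formula Θ} → φ ∼ ψ → ∀ {x} → (x FreeIn φ → x FreeIn ψ) × (x FreeIn ψ → x FreeIn φ)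
∼-free ∼refl        = id , id
∼-free (∼sym p)     = proj₂ (∼-free p) , proj₁ (∼-free p)
∼-free (∼trans p q) = proj₁ (∼-free q) ∘ proj₁ (∼-free p) , proj₂ (∼-free p) ∘ proj₂ (∼-free q)
∼-free (∼¬ p)       = ∼-free p
∼-free (∼□ p)       = ∼-free p
∼-free (∼∀ p)       = (λ (x≢y , i) → x≢y , proj₁ (∼-free p) i) , (λ (x≢y , i) → x≢y , proj₂ (∼-free p) i)
∼-free (∼→ p q)     = Sum.map (proj₁ (∼-free p)) (proj₁ (∼-free q)) , Sum.map (proj₂ (∼-free p)) (proj₂ (∼-free q))
∼-free (void x∉φ)   = proj₂ , λ i → (λ { refl → x∉φ i }) , i
∼-free (rename {x} {y} {φ} y∉φ) {z} = to , from
  where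
  to : z FreeIn ∀̇ x φ → z FreeIn ∀̇ y (φ [ x / var y ])
  to (z≢x , i) = (λ { refl → y∉φ (free⇒occurs φ i) }) ,
                 free-subst⁺ φ i (↦-other (var y) (z≢x ∘ sym)) λ _ → refl
  from : z FreeIn ∀̇ y (φ [ x / var y ]) → z FreeIn ∀̇ x φ
  from (z≢y , i) with free-subst⁻ φ i
  ... | w , j , eq with x ≟ w | eq
  ...   | yes _  | refl = ⊥-elim (z≢y refl)
  ...   | no x≢w | refl = (x≢w ∘ sym) , j

-- Normal forms

-- A formula modulo variants, with its free variables and constants interpreted
-- in K.  Void quantifiers disappear, and the bound variable of any other
-- quantifier is replaced by branching over K.
data Tree (Pr : Set) (ar : Pr → ℕ) (K : Set) : Set where
  atom : (P : Pr) → Vec K (ar P) → Tree Pr ar K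
  neg  : Tree Pr ar K → Tree Pr ar K
  box  : Tree Pr ar K → Tree Pr ar K
  all  : (K → Tree Pr ar K) → Tree Pr ar K
  imp  : Tree Pr ar K → Tree Pr ar K → Tree Pr ar K

infix 4 _≈_

-- Pointwise at `all`, which avoids function extensionality; in return, whatever is defined on trees
-- has to be shown to respect `≈`.
data _≈_ {Pr ar K} : Tree Pr ar K → Tree Pr ar K → Set where
  atom : ∀ {P ks ls} → ks ≡ ls → atom P ks ≈ atom P ls
  neg  : ∀ {t u} → t ≈ u → neg t ≈ neg u
  box  : ∀ {t u} → t ≈ u → box t ≈ box u
  all  : ∀ {f g} → (∀ k → f k ≈ g k) → all f ≈ all g
  imp  : ∀ {t t′ u u′} → t ≈ t′ → u ≈ u′ → imp t u ≈ imp t′ u′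

module _ {Pr : Set} {ar : Pr → ℕ} {K : Set} where

  ≈-refl : {t : Tree Pr ar K} → t ≈ t
  ≈-refl {atom P ks} = atom refl
  ≈-refl {neg t}     = neg ≈-refl
  ≈-refl {box t}     = box ≈-refl
  ≈-refl {all f}     = all λ k → ≈-refl
  ≈-refl {imp t u}   = imp ≈-refl ≈-refl

  ≈-reflexive : {t u : Tree Pr ar K} → t ≡ u → t ≈ u
  ≈-reflexive refl = ≈-refl

  ≈-sym : {t u : Tree Pr ar K} → t ≈ u → u ≈ t
  ≈-sym (atom eq) = atom (sym eq)
  ≈-sym (neg p)   = neg (≈-sym p)
  ≈-sym (box p)   = box (≈-sym p)
  ≈-sym (all p)   = all λ k → ≈-sym (p k)
  ≈-sym (imp p q) = imp (≈-sym p) (≈-sym q)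

  ≈-trans : {t u v : Tree Pr ar K} → t ≈ u → u ≈ v → t ≈ v
  ≈-trans (atom eq) (atom eq′) = atom (trans eq eq′)
  ≈-trans (neg p)   (neg q)    = neg (≈-trans p q)
  ≈-trans (box p)   (box q)    = box (≈-trans p q)
  ≈-trans (all p)   (all q)    = all λ k → ≈-trans (p k) (q k)
  ≈-trans (imp p q) (imp r s)  = imp (≈-trans p r) (≈-trans q s)

  -- The decision is an argument, so that `quantify-cong` can compare trees whose voidness tests
  -- concern different formulas.
  quantify : Dec A → (K → Tree Pr ar K) → Tree Pr ar K → Tree Pr ar K
  quantify (yes _) f t = all f
  quantify (no _)  f t = t

  quantify-cong : ∀ (d : Dec A) (d′ : Dec A′) {f f′ t t′} → (A → A′) → (A′ → A) →
                  (∀ k → f k ≈ f′ k) → (¬ A → t ≈ t′) → quantify d f t ≈ quantify d′ f′ t′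
  quantify-cong (yes a) (yes b) to from p q = all p
  quantify-cong (yes a) (no ¬b) to from p q = ⊥-elim (¬b (to a))
  quantify-cong (no ¬a) (yes b) to from p q = ⊥-elim (¬a (from b))
  quantify-cong (no ¬a) (no ¬b) to from p q = q ¬a

_[_:=_] : (Var → K) → Var → K → Var → K
(ρ [ x := k ]) y with x ≟ y
... | yes _ = k
... | no  _ = ρ y

evalTerm : (Const Θ → K) → (Var → K) → Term Θ → K
evalTerm κ ρ (var x) = ρ x
evalTerm κ ρ (con c) = κ c

-- r confines the quantifiers to the constants that a branch can instantiate.
tree : (Const Θ → K) → (K → K) → (Var → K) → Formula Θ → Tree (Pred Θ) (arity Θ) K
tree κ r ρ (atom P τs) = atom P (Vec.map (evalTerm κ ρ) τs)
tree κ r ρ (¬̇ φ)       = neg (tree κ r ρ φ)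
tree κ r ρ (□ φ)       = box (tree κ r ρ φ)
tree κ r ρ (∀̇ x φ)     = quantify (free? x φ) (λ k → tree κ r (ρ [ x := r k ]) φ) (tree κ r ρ φ)
tree κ r ρ (φ →̇ ψ)     = imp (tree κ r ρ φ) (tree κ r ρ ψ)

module _ {κ : Const Θ → K} {r : K → K} where

  tree-cong : ∀ (φ : Formula Θ) {ρ ρ′} → (∀ y → y FreeIn φ → ρ y ≡ ρ′ y) → tree κ r ρ φ ≈ tree κ r ρ′ φ
  tree-cong (atom P τs) {ρ} {ρ′} h = atom (map-cong-∈ τs agree)
    where
    agree : ∀ τ → τ Vec∈.∈ τs → evalTerm κ ρ τ ≡ evalTerm κ ρ′ τ
    agree (var y) i = h y i
    agree (con c) i = refl
  tree-cong (¬̇ φ)   h = neg (tree-cong φ h)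
  tree-cong (□ φ)   h = box (tree-cong φ h)
  tree-cong (∀̇ x φ) {ρ} {ρ′} h =
    quantify-cong (free? x φ) (free? x φ) id id
      (λ k → tree-cong φ (agree (r k)))
      (λ x∉φ → tree-cong φ λ y i → h y ((λ { refl → x∉φ i }) , i))
    where
    agree : ∀ k y → y FreeIn φ → (ρ [ x := k ]) y ≡ (ρ′ [ x := k ]) y
    agree k y i with x ≟ y
    ... | yes _  = refl
    ... | no x≢y = h y ((x≢y ∘ sym) , i)
  tree-cong (φ →̇ ψ) h = imp (tree-cong φ λ y → h y ∘ inj₁) (tree-cong ψ λ y → h y ∘ inj₂)

  tree-subst : ∀ (φ : Formula Θ) {σ ρ} → CaptureFree σ φ →
               tree κ r ρ (φ ⟪ σ ⟫) ≈ tree κ r (evalTerm κ ρ ∘ σ) φ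
  tree-subst (atom P τs) h =
    atom (trans (sym (Vec.map-∘ _ _ τs)) (Vec.map-cong (λ { (var _) → refl ; (con _) → refl }) τs))
  tree-subst (¬̇ φ) h = neg (tree-subst φ h)
  tree-subst (□ φ) h = box (tree-subst φ h)
  tree-subst (∀̇ x φ) {σ} {ρ} h =
    quantify-cong (free? x (φ ⟪ σ except x ⟫)) (free? x φ) to from
      (λ k → ≈-trans (tree-subst φ h′) (tree-cong φ λ y _ → agree (r k) y))
      (λ x∉φσ → ≈-trans (tree-subst φ h′) (tree-cong φ λ y i →
         cong (evalTerm κ ρ) (except-other σ {x} {y} λ { refl → x∉φσ (from i) })))
    where
    h′ : CaptureFree (σ except x) φ
    h′ = captureFree-∀ {x = x} {φ} h
    from : x FreeIn φ → x FreeIn φ ⟪ σ except x ⟫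
    from i = free-subst⁺ φ i (except-same σ x) λ _ → refl
    to : x FreeIn φ ⟪ σ except x ⟫ → x FreeIn φ
    to i with free-subst⁻ φ i
    ... | y , j , eq with x ≟ y
    ...   | yes refl = j
    ...   | no x≢y   = ⊥-elim (x≢y (sym (h y x (inj₁ refl) eq)))
    agree : ∀ k y → evalTerm κ (ρ [ x := k ]) ((σ except x) y) ≡ ((evalTerm κ ρ ∘ σ) [ x := k ]) y
    agree k y with x ≟ y
    agree k y | yes refl with x ≟ x
    ... | yes _  = refl
    ... | no x≢x = ⊥-elim (x≢x refl)
    agree k y | no x≢y with σ y in eq
    ... | con c = refl
    ... | var w with x ≟ w
    ...   | yes refl = ⊥-elim (x≢y (sym (h y x (inj₁ refl) eq)))
    ...   | no _     = refl
  tree-subst (φ →̇ ψ) h = imp (tree-subst φ λ y z → h y z ∘ inj₁) (tree-subst ψ λ y z → h y z ∘ inj₂)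

  tree-inst : ∀ x (φ : Formula Θ) c {ρ} → tree κ r ρ (φ [ x / con c ]) ≈ tree κ r (ρ [ x := κ c ]) φ
  tree-inst x φ c {ρ} = ≈-trans (tree-subst φ (captureFree-con x c φ)) (tree-cong φ λ y _ → agree y)
    where
    agree : ∀ y → evalTerm κ ρ ((x ↦ con c) y) ≡ (ρ [ x := κ c ]) y
    agree y with x ≟ y
    ... | yes _ = refl
    ... | no _  = refl

  tree-void : ∀ x (φ : Formula Θ) {ρ k} → ¬ (x FreeIn φ) → tree κ r (ρ [ x := k ]) φ ≈ tree κ r ρ φ
  tree-void x φ {ρ} {k} x∉φ = tree-cong φ agree
    where
    agree : ∀ y → y FreeIn φ → (ρ [ x := k ]) y ≡ ρ y
    agree y i with x ≟ y
    ... | yes refl = ⊥-elim (x∉φ i)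
    ... | no _     = refl

  -- Voidness is decided semantically and binders leave no name in the tree, so neither generator of
  -- `∼` is visible there. The converse is `≈⇒∼`.
  ∼⇒≈ : {φ ψ : Formula Θ} → φ ∼ ψ → ∀ ρ → tree κ r ρ φ ≈ tree κ r ρ ψ
  ∼⇒≈ ∼refl        ρ = ≈-refl
  ∼⇒≈ (∼sym p)     ρ = ≈-sym (∼⇒≈ p ρ)
  ∼⇒≈ (∼trans p q) ρ = ≈-trans (∼⇒≈ p ρ) (∼⇒≈ q ρ)
  ∼⇒≈ (∼¬ p)       ρ = neg (∼⇒≈ p ρ)
  ∼⇒≈ (∼□ p)       ρ = box (∼⇒≈ p ρ)
  ∼⇒≈ (∼∀ {x} {φ} {φ′} p) ρ =
    quantify-cong (free? x φ) (free? x φ′) (proj₁ (∼-free p)) (proj₂ (∼-free p))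
      (λ k → ∼⇒≈ p (ρ [ x := r k ])) (λ _ → ∼⇒≈ p ρ)
  ∼⇒≈ (∼→ p q)     ρ = imp (∼⇒≈ p ρ) (∼⇒≈ q ρ)
  ∼⇒≈ (void {x} {φ} x∉φ) ρ with free? x φ
  ... | yes x∈φ = ⊥-elim (x∉φ x∈φ)
  ... | no _    = ≈-refl
  ∼⇒≈ (rename {x} {y} {φ} y∉φ) ρ =
    quantify-cong (free? x φ) (free? y (φ [ x / var y ])) to from
      (λ k → ≈-sym (≈-trans (tree-subst φ cf) (tree-cong φ (agree (r k)))))
      (λ x∉φ → ≈-sym (≈-trans (tree-subst φ cf)
        (tree-cong φ λ z i → cong (evalTerm κ ρ) (↦-other {x = x} {z} (var y) λ { refl → x∉φ i }))))
    where
    cf : CaptureFree (x ↦ var y) φ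
    cf = captureFree-var x y φ y∉φ
    to : x FreeIn φ → y FreeIn φ [ x / var y ]
    to i = free-subst⁺ φ i (↦-same x (var y)) (⊥-elim ∘ y∉φ)
    from : y FreeIn φ [ x / var y ] → x FreeIn φ
    from i with free-subst⁻ φ i
    ... | z , j , eq with x ≟ z | eq
    ...   | yes refl | _    = j
    ...   | no _     | refl = ⊥-elim (y∉φ (free⇒occurs φ j))
    agree : ∀ k z → z FreeIn φ → evalTerm κ (ρ [ y := k ]) ((x ↦ var y) z) ≡ (ρ [ x := k ]) z
    agree k z i with x ≟ z
    agree k z i | yes _ with y ≟ y
    ... | yes _  = refl
    ... | no y≢y = ⊥-elim (y≢y refl)
    agree k z i | no _ with y ≟ z
    ... | yes refl = ⊥-elim (y∉φ (free⇒occurs φ i))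
    ... | no _     = refl

-- Normal forms of lifted formulas

free-lift⁺ : ∀ (φ : Formula Θ) {x} → x FreeIn φ → x FreeIn lift {X = X} φ
free-lift⁺ (atom P τs) i         = Vec∈.∈-map⁺ liftTerm i
free-lift⁺ (¬̇ φ)       i         = free-lift⁺ φ i
free-lift⁺ (□ φ)       i         = free-lift⁺ φ i
free-lift⁺ (∀̇ y φ)     (x≢y , i) = x≢y , free-lift⁺ φ i
free-lift⁺ (φ →̇ ψ)     (inj₁ i)  = inj₁ (free-lift⁺ φ i)
free-lift⁺ (φ →̇ ψ)     (inj₂ i)  = inj₂ (free-lift⁺ ψ i)

free-lift⁻ : ∀ (φ : Formula Θ) {x} → x FreeIn lift {X = X} φ → x FreeIn φ
free-lift⁻ (atom P τs) i with ∈-map⁻ liftTerm τs i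
... | var y , j , refl = j
... | con c , j , ()
free-lift⁻ (¬̇ φ)   i         = free-lift⁻ φ i
free-lift⁻ (□ φ)   i         = free-lift⁻ φ i
free-lift⁻ (∀̇ y φ) (x≢y , i) = x≢y , free-lift⁻ φ i
free-lift⁻ (φ →̇ ψ) (inj₁ i)  = inj₁ (free-lift⁻ φ i)
free-lift⁻ (φ →̇ ψ) (inj₂ i)  = inj₂ (free-lift⁻ ψ i)

tree-lift : ∀ {κ : Const (Θ ⊕ X) → K} {r ρ} (φ : Formula Θ) →
            tree κ r ρ (lift φ) ≈ tree (κ ∘ inj₁) r ρ φ
tree-lift (atom P τs) = atom (trans (sym (Vec.map-∘ _ _ τs)) (Vec.map-cong (λ { (var _) → refl ; (con _) → refl }) τs))
tree-lift (¬̇ φ)   = neg (tree-lift φ)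
tree-lift (□ φ)   = box (tree-lift φ)
tree-lift (∀̇ x φ) = quantify-cong (free? x (lift φ)) (free? x φ) (free-lift⁻ φ) (free-lift⁺ φ)
                                  (λ k → tree-lift φ) (λ _ → tree-lift φ)
tree-lift (φ →̇ ψ) = imp (tree-lift φ) (tree-lift ψ)

-- Reading a formula back from its normal form

module _ {Θ : Signature} where

  -- The new constant M + z stands for the bound variable z.
  unname : ℕ → Const (Θ ⊕ ℕ) → Term (Θ ⊕ ℕ)
  unname M (inj₁ c) = con (inj₁ c)
  unname M (inj₂ n) with M ≤? n
  ... | yes _ = var (n ∸ M)
  ... | no  _ = con (inj₂ n)

  -- This is the reification step of normalisation by evaluation: `z` is the next bound variable,
  -- and each branching function is probed at one generic constant only.
  readback : ℕ → Var → Tree (Pred Θ) (arity Θ) (Const (Θ ⊕ ℕ)) → Formula (Θ ⊕ ℕ)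
  readback M z (atom P ks) = atom P (Vec.map (unname M) ks)
  readback M z (neg t)     = ¬̇ readback M z t
  readback M z (box t)     = □ readback M z t
  readback M z (all f)     = ∀̇ z (readback M (suc z) (f (inj₂ (M + z))))
  readback M z (imp t u)   = readback M z t →̇ readback M z u

  -- One branch per quantifier is inspected, so pointwise equality of trees becomes genuine equality
  -- of formulas.
  readback-cong : ∀ M z {t u : Tree (Pred Θ) (arity Θ) (Const (Θ ⊕ ℕ))} → t ≈ u →
                  readback M z t ≡ readback M z u
  readback-cong M z (atom refl) = refl
  readback-cong M z (neg p)     = cong ¬̇_ (readback-cong M z p)
  readback-cong M z (box p)     = cong □_ (readback-cong M z p)
  readback-cong M z (all p)     = cong (∀̇ z) (readback-cong M (suc z) (p (inj₂ (M + z))))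
  readback-cong M z (imp p q)   = cong₂ _→̇_ (readback-cong M z p) (readback-cong M z q)

  unname-var : ∀ M z → unname M (inj₂ (M + z)) ≡ var z
  unname-var M z with M ≤? M + z
  ... | yes _ = cong var (m+n∸m≡n M z)
  ... | no ¬≤ = ⊥-elim (¬≤ (m≤m+n M z))

  module _ (r : Const (Θ ⊕ ℕ) → Const (Θ ⊕ ℕ)) (r-new : ∀ n → r (inj₂ n) ≡ inj₂ n) where

    module _ (N M : ℕ) where

      VarsBelow : Formula (Θ ⊕ ℕ) → Set
      VarsBelow φ = ∀ x → var x OccursIn φ → x < N

      NewBelow : Formula (Θ ⊕ ℕ) → Set
      NewBelow φ = ∀ n → con (inj₂ n) OccursIn φ → n < M

      private
        unname-con : ∀ {φ} → NewBelow φ → ∀ k → con k OccursIn φ → unname M k ≡ con k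
        unname-con h (inj₁ c) i = refl
        unname-con h (inj₂ n) i with M ≤? n
        ... | yes M≤n = ⊥-elim (<⇒≱ (h n i) M≤n)
        ... | no _    = refl

        ∼-quantify : ∀ {A : Set} {χ z f t} (d : Dec A) → (A → χ ∼ readback M z (all f)) →
                     (¬ A → χ ∼ readback M z t) → χ ∼ readback M z (quantify d f t)
        ∼-quantify (yes a) p q = p a
        ∼-quantify (no ¬a) p q = q ¬a

      -- The last two hypotheses are the invariant of the descent: variables already put in for
      -- bound ones lie in the interval from `N` to below `z`. Being at least `N` they do not occur
      -- in `φ`, so nothing is captured; being below `z` they leave `z` fresh for the next renaming.
      ∼-readback : ∀ φ {z ρ} → FixedBy r φ → VarsBelow φ → NewBelow φ → N ≤ z →
                   (∀ y w → unname M (ρ y) ≡ var w → N ≤ w × w < z) →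
                   φ ⟪ unname M ∘ ρ ⟫ ∼ readback M z (tree r r ρ φ)
      ∼-readback (atom P τs) {z} {ρ} fx vb nb N≤z h =
        subst (atom P (Vec.map (substTerm (unname M ∘ ρ)) τs) ∼_)
              (cong (atom P) (trans (map-cong-∈ τs agree) (Vec.map-∘ _ _ τs))) ∼refl
        where
        agree : ∀ τ → τ Vec∈.∈ τs → substTerm (unname M ∘ ρ) τ ≡ unname M (evalTerm r ρ τ)
        agree (var y) i = refl
        -- `FixedBy` removes `r`, and `NewBelow` keeps `unname` from turning the constant into a
        -- variable.
        agree (con c) i = sym (trans (cong (unname M) (fx c i)) (unname-con {atom P τs} nb c i))
      ∼-readback (¬̇ φ) fx vb nb N≤z h = ∼¬ (∼-readback φ fx vb nb N≤z h)
      ∼-readback (□ φ) fx vb nb N≤z h = ∼□ (∼-readback φ fx vb nb N≤z h)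
      ∼-readback (∀̇ x φ) {z} {ρ} fx vb nb N≤z h = ∼-quantify (free? x φ) nonvoid isVoid
        where
        ρ′ : Var → Const (Θ ⊕ ℕ)
        ρ′ = ρ [ x := r (inj₂ (M + z)) ]
        σ : Substitution (Θ ⊕ ℕ)
        σ = (unname M ∘ ρ) except x
        x<N : x < N
        x<N = vb x (inj₁ refl)
        IH : ∀ {z ρ} → N ≤ z → (∀ y w → unname M (ρ y) ≡ var w → N ≤ w × w < z) →
             φ ⟪ unname M ∘ ρ ⟫ ∼ readback M z (tree r r ρ φ)
        IH = ∼-readback φ (λ k → fx k ∘ inj₂) (λ y → vb y ∘ inj₂) (λ n → nb n ∘ inj₂)
        nonvoid : x FreeIn φ → ∀̇ x (φ ⟪ σ ⟫) ∼ ∀̇ z (readback M (suc z) (tree r r ρ′ φ))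
        -- Renaming `x` to `z` after `σ` amounts to the environment that sends `x` to the constant
        -- standing for `z`; by this equation the induction hypothesis applies under the quantifier.
        nonvoid _ = ∼trans (rename fresh)
          (∼∀ (subst (_∼ readback M (suc z) (tree r r ρ′ φ)) renamed (IH (m≤n⇒m≤1+n N≤z) h′)))
          where
          fresh : ¬ (var z OccursIn φ ⟪ σ ⟫)
          fresh i with occurs-subst φ i
          ... | inj₁ j = <⇒≱ (vb z (inj₂ j)) N≤z
          ... | inj₂ (y , eq) with x ≟ y | eq
          ...   | yes refl | refl = <⇒≱ x<N N≤z
          ...   | no _     | eq′  = n≮n z (proj₂ (h y z eq′))
          unname-z : unname M (r (inj₂ (M + z))) ≡ var z
          unname-z = trans (cong (unname M) (r-new (M + z))) (unname-var M z)
          cf : CaptureFree σ φ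
          cf y w i eq with x ≟ y | eq
          ... | yes refl | refl = refl
          ... | no _     | eq′  = ⊥-elim (<⇒≱ (vb w (inj₂ i)) (proj₁ (h y w eq′)))
          agree : ∀ y → y FreeIn φ → unname M (ρ′ y) ≡ substTerm (x ↦ var z) (σ y)
          agree y i with x ≟ y
          ... | yes refl = trans unname-z (sym (↦-same x (var z)))
          ... | no x≢y = sym (substTerm-other (var z) (unname M (ρ y)) λ eq → <⇒≱ x<N (proj₁ (h y x eq)))
          renamed : φ ⟪ unname M ∘ ρ′ ⟫ ≡ φ ⟪ σ ⟫ [ x / var z ]
          renamed = trans (subst-cong φ agree) (sym (subst-comp φ cf))
          h′ : ∀ y w → unname M (ρ′ y) ≡ var w → N ≤ w × w < suc z
          h′ y w eq with x ≟ y
          ... | no _  = proj₁ (h y w eq) , m<n⇒m<1+n (proj₂ (h y w eq))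
          ... | yes _ with trans (sym unname-z) eq
          ...   | refl = N≤z , n<1+n z
        isVoid : ¬ (x FreeIn φ) → ∀̇ x (φ ⟪ σ ⟫) ∼ readback M z (tree r r ρ φ)
        isVoid x∉φ = ∼trans (void x∉φσ)
          (subst (_∼ readback M z (tree r r ρ φ)) (subst-cong φ agree) (IH N≤z h))
          where
          agree : ∀ y → y FreeIn φ → unname M (ρ y) ≡ σ y
          agree y i = sym (except-other (unname M ∘ ρ) {x} {y} λ { refl → x∉φ i })
          x∉φσ : ¬ (x FreeIn φ ⟪ σ ⟫)
          x∉φσ i with free-subst⁻ φ i
          ... | y , j , eq = <⇒≱ x<N (proj₁ (h y x (trans (agree y j) eq)))
      ∼-readback (φ →̇ ψ) fx vb nb N≤z h =
        ∼→ (∼-readback φ (λ k → fx k ∘ inj₁) (λ y → vb y ∘ inj₁) (λ n → nb n ∘ inj₁) N≤z h)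
           (∼-readback ψ (λ k → fx k ∘ inj₂) (λ y → vb y ∘ inj₂) (λ n → nb n ∘ inj₂) N≤z h)

    ≈⇒∼ : ∀ φ ψ → Closed φ → Closed ψ → FixedBy r φ → FixedBy r ψ →
          tree r r (λ _ → inj₂ 0) φ ≈ tree r r (λ _ → inj₂ 0) ψ → φ ∼ ψ
    ≈⇒∼ φ ψ pφ pψ fφ fψ t≈u =
      ∼trans (readable φ pφ fφ (s≤s (m≤m+n _ _)) (s≤s (m≤m+n _ _)))
        (subst (_∼ ψ) (sym (readback-cong M N t≈u))
          (∼sym (readable ψ pψ fψ (s≤s (m≤n+m _ (weight varIndex φ))) (s≤s (m≤n+m _ (weight newIndex φ))))))
      where
      N M : ℕ
      -- One pair of bounds serves both formulas, so that their trees are read back with the same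
      -- names.
      N = suc (weight varIndex φ + weight varIndex ψ)
      M = suc (weight newIndex φ + weight newIndex ψ)
      readable : ∀ χ → Closed χ → FixedBy r χ → weight varIndex χ < N → weight newIndex χ < M →
                 χ ∼ readback M N (tree r r (λ _ → inj₂ 0) χ)
      readable χ p fx v<N n<M = subst (_∼ readback M N (tree r r (λ _ → inj₂ 0) χ)) (subst-closed χ p)
        (∼-readback N M χ {N} {λ _ → inj₂ 0} fx
          (λ x i → ≤-<-trans (occurs⇒≤weight varIndex χ i) v<N)
          -- `M` is a successor, so `unname M` leaves `inj₂ 0` a constant and the condition on
          -- variables is vacuous.
          (λ n i → ≤-<-trans (occurs⇒≤weight newIndex χ i) n<M) ≤-refl λ _ _ ())

-- Hintikka sets

-- Minimality of `L`, split into membership and the lower bound at the single constant `k`. For `𝐅`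
-- the bound is trivial, which matches a rule that yields only one instance.
record Instantiated (r : Const Θ → Const Θ) (H : Signed Θ → Set) (k : Const Θ)
                    (L : TV) (x : Var) (φ : Formula Θ) .(p : Closed (∀̇ x φ)) : Set where
  field
    attained : ∃[ c ] r c ≡ c × H (L ∶ inst x φ p c)
    bounded  : L ≡ 𝐅 ⊎ (∃[ L′ ] rank L ≤ rank L′ × H (L′ ∶ inst x φ p k))

Expanded : (Signed Θ → Set) → Signed Θ → Set
Expanded H s = ∀ {alts} → s ⟶ alts → Any (All H) alts

-- The index `k` cuts the infinite demand of a quantified sentence into tasks that one extension can
-- settle.
Fulfilled : (Const Θ → Const Θ) → (Signed Θ → Set) → Const Θ → Signed Θ → Set
Fulfilled r H k (L ∶ (∀̇ x φ , [ p ])) = Instantiated r H k L x φ p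
Fulfilled r H k s@(_ ∶ (atom _ _ , _)) = Expanded H s
Fulfilled r H k s@(_ ∶ (¬̇ _ , _))      = Expanded H s
Fulfilled r H k s@(_ ∶ (□ _ , _))      = Expanded H s
Fulfilled r H k s@(_ ∶ (_ →̇ _ , _))    = Expanded H s

-- `H` occurs only positively, so a task once settled stays settled as the branch grows.
Fulfilled-mono : ∀ {r : Const Θ → Const Θ} {H H′ : Signed Θ → Set} →
                 (∀ {s} → H s → H′ s) → ∀ {k} s → Fulfilled r H k s → Fulfilled r H′ k s
Fulfilled-mono H⊆ (L ∶ (∀̇ x φ , [ p ])) q = record
  { attained = let (c , fc , h) = attained in c , fc , H⊆ h
  ; bounded  = Sum.map₂ (λ (L′ , le , h) → L′ , le , H⊆ h) bounded }
  where open Instantiated q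
Fulfilled-mono H⊆ (_ ∶ (atom _ _ , _)) q rule = Any.map (All.map H⊆) (q rule)
Fulfilled-mono H⊆ (_ ∶ (¬̇ _ , _))      q rule = Any.map (All.map H⊆) (q rule)
Fulfilled-mono H⊆ (_ ∶ (□ _ , _))      q rule = Any.map (All.map H⊆) (q rule)
Fulfilled-mono H⊆ (_ ∶ (_ →̇ _ , _))    q rule = Any.map (All.map H⊆) (q rule)

record Hintikka (r : Const Θ → Const Θ) (H : Signed Θ → Set) : Set where
  field
    consistent : ∀ {s s′} → H s → H s′ → value (sentence s) ∼ value (sentence s′) → sign s ≡ sign s′
    fixed      : ∀ {s} → H s → FixedBy r (value (sentence s))
    fulfilled  : ∀ {s} k → H s → Fulfilled r H (r k) s

-- Closing tableaux

⟶-deterministic : ∀ {s : Signed Θ} {alts alts′} → s ⟶ alts → s ⟶ alts′ → alts ≡ alts′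
⟶-deterministic T¬ T¬ = refl
⟶-deterministic t¬ t¬ = refl
⟶-deterministic f¬ f¬ = refl
⟶-deterministic F¬ F¬ = refl
⟶-deterministic T□ T□ = refl
⟶-deterministic t□ t□ = refl
⟶-deterministic f□ f□ = refl
⟶-deterministic F□ F□ = refl
⟶-deterministic T→ T→ = refl
⟶-deterministic t→ t→ = refl
⟶-deterministic f→ f→ = refl
⟶-deterministic F→ F→ = refl

-- Carries `FixedBy` from a premise to the alternatives of its rule.
⟶-occurs : ∀ {s : Signed Θ} {alts} → s ⟶ alts →
           All (All λ s′ → ∀ {τ} → τ OccursIn value (sentence s′) → τ OccursIn value (sentence s)) alts
⟶-occurs T¬ = (id ∷ []) ∷ []
⟶-occurs t¬ = (id ∷ []) ∷ []
⟶-occurs f¬ = (id ∷ []) ∷ []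
⟶-occurs F¬ = (id ∷ []) ∷ []
⟶-occurs T□ = (id ∷ []) ∷ []
⟶-occurs t□ = (id ∷ []) ∷ []
⟶-occurs f□ = (id ∷ []) ∷ (id ∷ []) ∷ (id ∷ []) ∷ []
⟶-occurs F□ = (id ∷ []) ∷ (id ∷ []) ∷ (id ∷ []) ∷ []
⟶-occurs T→ = (inj₁ ∷ []) ∷ (inj₁ ∷ inj₂ ∷ []) ∷ (inj₁ ∷ inj₂ ∷ []) ∷ (inj₁ ∷ inj₂ ∷ []) ∷ (inj₂ ∷ []) ∷ []
⟶-occurs t→ = (inj₁ ∷ inj₂ ∷ []) ∷ (inj₁ ∷ inj₂ ∷ []) ∷ (inj₁ ∷ inj₂ ∷ []) ∷ (inj₁ ∷ inj₂ ∷ []) ∷ []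
⟶-occurs f→ = (inj₁ ∷ inj₂ ∷ []) ∷ (inj₁ ∷ inj₂ ∷ []) ∷ (inj₁ ∷ inj₂ ∷ []) ∷ []
⟶-occurs F→ = (inj₁ ∷ inj₂ ∷ []) ∷ []

Closable : Branch Θ → Set
Closable B = Σ[ t ∈ Tableau B ] ClosedTableau t

closable-node : ∀ {B : Branch Θ} {Bs} → Step B Bs → All Closable Bs → Closable B
closable-node step cs = node step (proj₁ (unzip cs)) , proj₂ (unzip cs)
  where
  unzip : ∀ {Bs} → All Closable Bs → Σ[ ts ∈ All Tableau Bs ] All ClosedBranch (branchesAll ts)
  unzip []            = [] , []
  unzip ((t , c) ∷ cs) = t ∷ proj₁ (unzip cs) , ++⁺ c (proj₂ (unzip cs))

-- Extending branches that cannot be closed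

module Search (em : ExcludedMiddle 0ℓ) {Θ : Signature} (r : Const (Θ ⊕ ℕ) → Const (Θ ⊕ ℕ))
              (r-new : ∀ n → r (inj₂ n) ≡ inj₂ n) (r-idem : ∀ k → r (r k) ≡ r k)
              (enum : ℕ → Const (Θ ⊕ ℕ)) (enum-onto : ∀ k → ∃[ j ] r (enum j) ≡ r k) where

  -- Contrapositive of `closable-node`: closed tableaux for all successors would combine into one
  -- for `B`.
  open-step : ∀ {B : Branch (Θ ⊕ ℕ)} {Bs} → Step B Bs → ¬ Closable B → Any (¬_ ∘ Closable) Bs
  open-step {Bs = Bs} step open-B = ¬All⇒Any¬ (λ _ → em) Bs (open-B ∘ closable-node step)

  -- `witnessed` is needed because a witnessing rule cannot be repeated: once it has been applied,
  -- the instance it produced must be recoverable from the record.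
  record Extendable (B : Branch (Θ ⊕ ℕ)) : Set where
    field
      unclosable : ¬ Closable B
      fixed      : ∀ {s} → s ∈ formulas B → FixedBy r (value (sentence s))
      witnessed  : ∀ {L x φ} .{p : Closed (∀̇ x φ)} {c} → (L ∶ ∀ˢ x φ p , c) ∈ witnesses B →
                   r c ≡ c × L ∶ inst x φ p c ∈ formulas B

  open Extendable

  -- `Q` speaks of a set of signed sentences rather than of a branch, so that what is achieved can
  -- be transferred to later branches and to their union `Reached`.
  record Extension (B : Branch (Θ ⊕ ℕ)) (Q : (Signed (Θ ⊕ ℕ) → Set) → Set) : Set where
    constructor extension
    field
      branch′    : Branch (Θ ⊕ ℕ)
      extendable : Extendable branch′
      extends    : formulas B ⊆ formulas branch′
      achieves   : Q (_∈ formulas branch′)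

  extendable-▸ : ∀ {B ss} → Extendable B → ¬ Closable (B ▸ ss) →
                 All (λ s → FixedBy r (value (sentence s))) ss → Extendable (B ▸ ss)
  extendable-▸ {B} {ss} ok open-B′ fx = record
    { unclosable = open-B′
    ; fixed      = λ i → [ All.lookup fx , fixed ok ]′ (∈-++⁻ ss i)
    ; witnessed  = λ i → proj₁ (witnessed ok i) , ∈-++⁺ʳ ss (proj₂ (witnessed ok i)) }

  extendable-witness : ∀ {B ss L x φ} .{p : Closed (∀̇ x φ)} {c} → Extendable B →
                       ¬ Closable (B ▸ ss witness (L ∶ ∀ˢ x φ p , c)) →
                       All (λ s → FixedBy r (value (sentence s))) ss →
                       r c ≡ c → L ∶ inst x φ p c ∈ ss →
                       Extendable (B ▸ ss witness (L ∶ ∀ˢ x φ p , c))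
  extendable-witness {B} {ss} ok open-B′ fx fc j = record
    { unclosable = open-B′
    ; fixed      = λ i → [ All.lookup fx , fixed ok ]′ (∈-++⁻ ss i)
    ; witnessed  = λ where
        (here refl) → fc , ∈-++⁺ˡ j
        (there i)   → proj₁ (witnessed ok i) , ∈-++⁺ʳ ss (proj₂ (witnessed ok i)) }

  fixed-inst : ∀ {B L x φ} .{p : Closed (∀̇ x φ)} {c} → Extendable B → L ∶ ∀ˢ x φ p ∈ formulas B →
               r c ≡ c → FixedBy r (φ [ x / con c ])
  fixed-inst {x = x} {φ} {c = c} ok i fc k j with occurs-inst x φ c j
  ... | inj₁ j′   = fixed ok i k (inj₂ j′)
  ... | inj₂ refl = fc

  expand : ∀ {B} → Extendable B → ∀ {s} → s ∈ formulas B → Extension B λ H → Expanded H s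
  expand {B} ok {s} i with em {∃[ alts ] s ⟶ alts}
  ... | no ¬rule = extension B ok id λ rule → ⊥-elim (¬rule (_ , rule))
  ... | yes (alts , rule) with find (Anyₚ.map⁻ (open-step (prop i rule) (unclosable ok)))
  ...   | ss , ss∈alts , open-B′ = extension (B ▸ ss)
            (extendable-▸ ok open-B′ (All.map (λ occ k j → fixed ok i k (occ j)) (All.lookup (⟶-occurs rule) ss∈alts)))
            (∈-++⁺ʳ ss)
            -- `Expanded` ranges over all rules for `s`; determinism identifies each with the one
            -- just applied.
            λ rule′ → subst (Any _) (⟶-deterministic rule rule′) (lose ss∈alts (All.tabulate ∈-++⁺ˡ))

  -- The constant must also differ from `k`, since `k` will serve as the second constant of the
  -- rules for `𝐭` and `𝐟`.
  fresh : ∀ B (k : Const (Θ ⊕ ℕ)) → ∃[ n ] NewOn (inj₂ n) B × k ≢ inj₂ n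
  fresh B k = n , new , k≢n
    where
    size : List (Signed (Θ ⊕ ℕ)) → ℕ
    size []       = 0
    size (s ∷ ss) = weight newIndex (value (sentence s)) + size ss
    ≤size : ∀ {ss s} → s ∈ ss → weight newIndex (value (sentence s)) ≤ size ss
    ≤size (here refl)              = m≤m+n _ _
    ≤size {s′ ∷ ss} (there i) = ≤-trans (≤size i) (m≤n+m _ (weight newIndex (value (sentence s′))))
    n : ℕ
    n = suc (newIndex {Θ} (con k) + size (formulas B))
    new : NewOn (inj₂ n) B
    new s i j = <⇒≱ (n<1+n _) (≤-trans (occurs⇒≤weight newIndex (value (sentence s)) j)
                               (≤-trans (≤size i) (m≤n+m _ (newIndex {Θ} (con k)))))
    k≢n : k ≢ inj₂ n
    k≢n k≡n = <⇒≱ (s≤s (m≤m+n (newIndex {Θ} (con k)) (size (formulas B)))) (≤-reflexive (sym (cong (newIndex {Θ} ∘ con) k≡n)))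

  module _ {B L x φ} .{p : Closed (∀̇ x φ)} (ok : Extendable B) (s∈B : L ∶ ∀ˢ x φ p ∈ formulas B)
           {k} (fk : r k ≡ k) where

    instantiate-new : ∀ {n L′} → rank L ≤ rank L′ →
      ¬ Closable (B ▸ (L ∶ inst x φ p (inj₂ n) ∷ L′ ∶ inst x φ p k ∷ []) witness (L ∶ ∀ˢ x φ p , inj₂ n)) →
      Extension B λ H → Instantiated r H k L x φ p
    instantiate-new {n} {L′} le open-B′ = extension _
      (extendable-witness ok open-B′ (fixed-inst ok s∈B (r-new n) ∷ fixed-inst ok s∈B fk ∷ []) (r-new n) (here refl))
      (λ i → there (there i))
      record { attained = inj₂ n , r-new n , here refl ; bounded = inj₂ (L′ , le , there (here refl)) }

    instantiate-again : ∀ {c L′} → r c ≡ c → L ∶ inst x φ p c ∈ L′ ∶ inst x φ p k ∷ formulas B → rank L ≤ rank L′ →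
      ¬ Closable (B ▸ (L′ ∶ inst x φ p k ∷ [])) →
      Extension B λ H → Instantiated r H k L x φ p
    instantiate-again {c} {L′} fc i le open-B′ = extension _
      (extendable-▸ ok open-B′ (fixed-inst ok s∈B fk ∷ []))
      there
      record { attained = c , fc , i ; bounded = inj₂ (L′ , le , here refl) }

    instantiate-witness : L ∶ inst x φ p k ∈ formulas B → Extension B λ H → Instantiated r H k L x φ p
    instantiate-witness i = extension B ok id
      record { attained = k , fk , i ; bounded = inj₂ (L , ≤-refl , i) }

  -- The same `k` is used in all alternatives of a rule, so that each of them bounds the instance at
  -- `k` from below. The final argument tells whether the witnessing rule has already been spent.
  instantiate : ∀ {B x φ} .{p : Closed (∀̇ x φ)} → Extendable B → ∀ L → L ∶ ∀ˢ x φ p ∈ formulas B →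
                ∀ {k} → r k ≡ k →
                Dec (∃[ c ] (L ∶ ∀ˢ x φ p , c) ∈ witnesses B) → Extension B λ H → Instantiated r H k L x φ p
  instantiate ok 𝐓 i {k} fk _ with open-step (T∀ i k) (unclosable ok)
  ... | here open-B′ = instantiate-again ok i fk fk (here refl) ≤-refl open-B′
  -- The rule cannot be applied again; the recorded witness supplies the instance.
  instantiate {B} ok 𝐅 i fk (yes (c , w)) = extension B ok id
    record { attained = c , witnessed ok w ; bounded = inj₁ refl }
  instantiate {B} ok 𝐅 i {k} fk (no unwitnessed) with fresh B k
  ... | n , new , k≢n with open-step (F∀ i (λ c w → unwitnessed (c , w)) (inj₂ n) new) (unclosable ok)
  ...   | here open-B′ = extension _
            (extendable-witness ok open-B′ (fixed-inst ok i (r-new n) ∷ []) (r-new n) (here refl)) there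
            record { attained = inj₂ n , r-new n , here refl ; bounded = inj₁ refl }
  instantiate ok 𝐭 i {k} fk (yes (c , w)) with em {k ≡ c}
  -- Reuse excludes the witness itself, but its instance already has sign `𝐭`, which is bound
  -- enough.
  ... | yes refl = instantiate-witness ok i fk (proj₂ (witnessed ok w))
  ... | no k≢c with witnessed ok w | open-step (t∀-again w k k k≢c k≢c) (unclosable ok)
  ...   | fc , j | here open-B′         = instantiate-again ok i fk fc (there j) ≤-refl open-B′
  ...   | fc , j | there (here open-B′) = instantiate-again ok i fk fc (there j) (n≤1+n 2) open-B′
  instantiate {B} ok 𝐭 i {k} fk (no unwitnessed) with fresh B k
  ... | n , new , k≢n with open-step (t∀ i (λ c w → unwitnessed (c , w)) (inj₂ n) k new k≢n) (unclosable ok)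
  ...   | here open-B′         = instantiate-new ok i fk ≤-refl open-B′
  ...   | there (here open-B′) = instantiate-new ok i fk (n≤1+n 2) open-B′
  instantiate ok 𝐟 i {k} fk (yes (c , w)) with em {k ≡ c}
  ... | yes refl = instantiate-witness ok i fk (proj₂ (witnessed ok w))
  ... | no k≢c with witnessed ok w | open-step (f∀-again w k k k k≢c k≢c k≢c) (unclosable ok)
  ...   | fc , j | here open-B′                 = instantiate-again ok i fk fc (there j) ≤-refl open-B′
  ...   | fc , j | there (here open-B′)         = instantiate-again ok i fk fc (there j) (m≤n+m 1 2) open-B′
  ...   | fc , j | there (there (here open-B′)) = instantiate-again ok i fk fc (there j) (n≤1+n 1) open-B′
  instantiate {B} ok 𝐟 i {k} fk (no unwitnessed) with fresh B k
  ... | n , new , k≢n with open-step (f∀ i (λ c w → unwitnessed (c , w)) (inj₂ n) k new k≢n) (unclosable ok)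
  ...   | here open-B′                 = instantiate-new ok i fk ≤-refl open-B′
  ...   | there (here open-B′)         = instantiate-new ok i fk (m≤n+m 1 2) open-B′
  ...   | there (there (here open-B′)) = instantiate-new ok i fk (n≤1+n 1) open-B′

  fulfil : ∀ {B} → Extendable B → ∀ s → s ∈ formulas B → ∀ {k} → r k ≡ k → Extension B λ H → Fulfilled r H k s
  fulfil ok (L ∶ (∀̇ x φ , [ p ])) i fk = instantiate ok L i fk em
  fulfil ok (_ ∶ (atom _ _ , _))  i fk = expand ok i
  fulfil ok (_ ∶ (¬̇ _ , _))       i fk = expand ok i
  fulfil ok (_ ∶ (□ _ , _))       i fk = expand ok i
  fulfil ok (_ ∶ (_ →̇ _ , _))     i fk = expand ok i

  -- The fair construction

  Task : Set
  Task = Signed (Θ ⊕ ℕ) × ℕ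

  Done : Task → (Signed (Θ ⊕ ℕ) → Set) → Set
  Done (s , j) H = Fulfilled r H (r (enum j)) s

  fulfilAll : ∀ {B} → Extendable B → (tasks : List Task) → All (λ (s , _) → s ∈ formulas B) tasks →
              Extension B λ H → All (λ t → Done t H) tasks
  fulfilAll {B} ok [] [] = extension B ok id []
  fulfilAll ok ((s , j) ∷ tasks) (i ∷ is) with fulfil ok s i (r-idem (enum j))
  ... | extension B₁ ok₁ ⊆₁ done with fulfilAll ok₁ tasks (All.map ⊆₁ is)
  ...   | extension B₂ ok₂ ⊆₂ dones = extension B₂ ok₂ (⊆₂ ∘ ⊆₁) (Fulfilled-mono ⊆₂ s done ∷ dones)

  module _ {s₀} (ok₀ : Extendable (root s₀)) where

    -- Dovetailing: the pair of `s` and `j` is treated at every stage `n` that has `s` on its branch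
    -- and exceeds `j`.
    tasks : Branch (Θ ⊕ ℕ) → ℕ → List Task
    tasks B n = cartesianProduct (formulas B) (upTo n)

    mutual
      stage : ℕ → Σ[ B ∈ Branch (Θ ⊕ ℕ) ] Extendable B
      stage zero    = root s₀ , ok₀
      stage (suc n) = Extension.branch′ (next n) , Extension.extendable (next n)

      next : ∀ n → Extension (proj₁ (stage n)) λ H → All (λ t → Done t H) (tasks (proj₁ (stage n)) n)
      next n = fulfilAll (proj₂ (stage n)) (tasks B n)
        (All.tabulate λ {t} i → proj₁ (∈-cartesianProduct⁻ (formulas B) (upTo n) i))
        where
        B : Branch (Θ ⊕ ℕ)
        B = proj₁ (stage n)

    Reached : Signed (Θ ⊕ ℕ) → Set
    Reached s = ∃[ n ] s ∈ formulas (proj₁ (stage n))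

    stage-mono : ∀ d n → formulas (proj₁ (stage n)) ⊆ formulas (proj₁ (stage (d + n)))
    stage-mono zero    n = id
    stage-mono (suc d) n = Extension.extends (next (d + n)) ∘ stage-mono d n

    reached-hintikka : Hintikka r Reached
    reached-hintikka = record
      { consistent = consistent
      ; fixed      = λ (n , i) → fixed (proj₂ (stage n)) i
      ; fulfilled  = fulfilled }
      where
      consistent : ∀ {s s′} → Reached s → Reached s′ → value (sentence s) ∼ value (sentence s′) → sign s ≡ sign s′
      consistent {s} {s′} (m , i) (n , j) v with em {sign s ≡ sign s′}
      ... | yes eq = eq
      -- Both lie on the branch of a common later stage, which a bare leaf would then close.
      ... | no neq = ⊥-elim (unclosable (proj₂ (stage (n + m)))
              (leaf , (s , s′ , stage-mono n m i ,
                subst (λ l → s′ ∈ formulas (proj₁ (stage l))) (+-comm m n) (stage-mono m n j) , v , neq) ∷ []))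
      fulfilled : ∀ {s} k → Reached s → Fulfilled r Reached (r k) s
      fulfilled {s} k (m , i) with enum-onto k
      ... | j , eq = subst (λ k → Fulfilled r Reached k s) eq
              (Fulfilled-mono {r = r} (λ i → suc l , i) s
                (All.lookup (Extension.achieves (next l))
                  (∈-cartesianProduct⁺ (stage-mono (suc j) m i) (∈-upTo⁺ (s≤s (m≤m+n j m))))))
        where
        l : ℕ
        -- Late enough for `s` to be present and for `j` to be below the stage number.
        l = suc j + m

-- The truth tables

rank-injective : ∀ a b → rank a ≡ rank b → a ≡ b
rank-injective 𝐓 𝐓 _ = refl
rank-injective 𝐭 𝐭 _ = refl
rank-injective 𝐟 𝐟 _ = refl
rank-injective 𝐅 𝐅 _ = refl

∀̃-unique : ∀ {X : TV → Set} {a b} → ∀̃ᵈ₄ X a → ∀̃ᵈ₄ X b → a ≡ b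
∀̃-unique (a∈X , a≤) (b∈X , b≤) = rank-injective _ _ (≤-antisym (a≤ _ b∈X) (b≤ _ a∈X))

∀̃-cong : ∀ {X Y : TV → Set} {a} → (∀ {b} → X b → Y b) → (∀ {b} → Y b → X b) → ∀̃ᵈ₄ X a → ∀̃ᵈ₄ Y a
∀̃-cong to from (a∈X , a≤) = to a∈X , λ b → a≤ b ∘ from

∀̃-singleton : ∀ a → ∀̃ᵈ₄ (a ≡_) a
∀̃-singleton a = refl , λ { b refl → ≤-refl }

-- This choice and the next two depend on the truth values alone, which is why default values
-- respect `≈`.
some-¬ : ∀ a → ∃[ b ] b ∈ ¬̃ a
some-¬ 𝐓 = 𝐅 , here refl
some-¬ 𝐭 = 𝐟 , here refl
some-¬ 𝐟 = 𝐭 , here refl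
some-¬ 𝐅 = 𝐓 , here refl

some-□ : ∀ a → ∃[ b ] b ∈ □̃₁ a
some-□ 𝐓 = 𝐓 , here refl
some-□ 𝐭 = 𝐟 , here refl
some-□ 𝐟 = 𝐟 , here refl
some-□ 𝐅 = 𝐟 , here refl

some-→ : ∀ a b → ∃[ c ] c ∈ a →̃ b
some-→ 𝐓 b = b , here refl
some-→ 𝐭 𝐓 = 𝐓 , here refl
some-→ 𝐭 𝐭 = 𝐓 , here refl
some-→ 𝐭 𝐟 = 𝐟 , here refl
some-→ 𝐭 𝐅 = 𝐟 , here refl
some-→ 𝐟 𝐓 = 𝐓 , here refl
some-→ 𝐟 𝐭 = 𝐓 , here refl
some-→ 𝐟 𝐟 = 𝐓 , here refl
some-→ 𝐟 𝐅 = 𝐭 , here refl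
some-→ 𝐅 b = 𝐓 , here refl

Undesignated : TV → Set
Undesignated a = a ∈ 𝐅 ∷ 𝐟 ∷ []

undesignated⇒¬designated : ∀ {a} → Undesignated a → ¬ Designated a
undesignated⇒¬designated (here refl) (here ())
undesignated⇒¬designated (here refl) (there (here ()))
undesignated⇒¬designated (here refl) (there (there ()))
undesignated⇒¬designated (there (here refl)) (here ())
undesignated⇒¬designated (there (here refl)) (there (here ()))
undesignated⇒¬designated (there (here refl)) (there (there ()))

-- Up to designation, `→̃` is classical implication.
undesignated-→ : ∀ a b {c} → c ∈ a →̃ b → Undesignated c → Designated a × Undesignated b
undesignated-→ 𝐓 b (here refl) u = here refl , u
undesignated-→ 𝐭 𝐟 (here refl) u = there (here refl) , there (here refl)
undesignated-→ 𝐭 𝐅 (here refl) u = there (here refl) , here refl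
undesignated-→ 𝐭 𝐓 (here refl) (there (there ()))
undesignated-→ 𝐭 𝐭 (here refl) (there (there ()))
undesignated-→ 𝐭 𝐭 (there (here refl)) (there (there ()))
undesignated-→ 𝐟 𝐓 (here refl) (there (there ()))
undesignated-→ 𝐟 𝐭 (here refl) (there (there ()))
undesignated-→ 𝐟 𝐭 (there (here refl)) (there (there ()))
undesignated-→ 𝐟 𝐟 (here refl) (there (there ()))
undesignated-→ 𝐟 𝐟 (there (here refl)) (there (there ()))
undesignated-→ 𝐟 𝐅 (here refl) (there (there ()))
undesignated-→ 𝐅 b (here refl) (there (there ()))

𝐓∈→̃𝐓 : ∀ a → 𝐓 ∈ a →̃ 𝐓
𝐓∈→̃𝐓 𝐓 = here refl
𝐓∈→̃𝐓 𝐭 = here refl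
𝐓∈→̃𝐓 𝐟 = here refl
𝐓∈→̃𝐓 𝐅 = here refl

-- The valuation of a Hintikka set

module Model (em : ExcludedMiddle 0ℓ) {Θ : Signature} (r : Const (Θ ⊕ ℕ) → Const (Θ ⊕ ℕ))
             (r-new : ∀ n → r (inj₂ n) ≡ inj₂ n) (r-idem : ∀ k → r (r k) ≡ r k)
             (H : Signed (Θ ⊕ ℕ) → Set) (hintikka : Hintikka r H) where

  open Hintikka hintikka

  NF : Set
  NF = Tree (Pred Θ) (arity Θ) (Const (Θ ⊕ ℕ))

  ρ₀ : Var → Const (Θ ⊕ ℕ)
  ρ₀ _ = inj₂ 0

  nf : Formula (Θ ⊕ ℕ) → NF
  nf = tree r r ρ₀

  Labelled : TV → NF → Set
  Labelled L t = ∃[ φ ] H (L ∶ φ) × nf (value φ) ≈ t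

  labelled-≈ : ∀ {L t u} → t ≈ u → Labelled L t → Labelled L u
  labelled-≈ t≈u (φ , h , eq) = φ , h , ≈-trans eq t≈u

  -- Here reading back pays off: two sentences of `H` with one normal form are variants, so
  -- consistency applies.
  labelled-unique : ∀ {L L′ t} → Labelled L t → Labelled L′ t → L ≡ L′
  labelled-unique ((φ , [ p ]) , h , eq) ((ψ , [ q ]) , h′ , eq′) = consistent h h′
    (≈⇒∼ r r-new φ ψ (recompute-closed φ p) (recompute-closed ψ q) (fixed h) (fixed h′) (≈-trans eq (≈-sym eq′)))

  -- Termination measure for `labelled-shape`: an instance is no subformula, but it has one leading
  -- quantifier fewer.
  depth : Formula (Θ ⊕ ℕ) → ℕ
  depth (∀̇ x φ) = suc (depth φ)
  depth _       = 0

  depth-subst : ∀ φ {σ} → depth (φ ⟪ σ ⟫) ≡ depth φ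
  depth-subst (atom P τs) = refl
  depth-subst (¬̇ φ)       = refl
  depth-subst (□ φ)       = refl
  depth-subst (∀̇ x φ)     = cong suc (depth-subst φ)
  depth-subst (φ →̇ ψ)     = refl

  data Shape (L : TV) : NF → Set where
    atom : ∀ {P ks} → Shape L (atom P ks)
    neg  : ∀ {t} φ → H (L ∶ ¬ˢ φ) → nf (value φ) ≈ t → Shape L (neg t)
    box  : ∀ {t} φ → H (L ∶ □ˢ φ) → nf (value φ) ≈ t → Shape L (box t)
    all  : ∀ {f} x φ .(p : Closed (∀̇ x φ)) → H (L ∶ ∀ˢ x φ p) →
           (∀ k → nf (φ [ x / con (r k) ]) ≈ f k) → Shape L (all f)
    imp  : ∀ {t u} φ ψ → H (L ∶ (φ →ˢ ψ)) → nf (value φ) ≈ t → nf (value ψ) ≈ u → Shape L (imp t u)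

  -- The label may come from a sentence with void quantifiers in front. The attained instance of
  -- such a quantification has the same sign and the same normal form, so it can take its place.
  labelled-shape : ∀ {L t} → Labelled L t → Shape L t
  labelled-shape {L} (φ , h , eq) = strip (depth (value φ)) φ ≤-refl h eq
    where
    strip : ∀ n {t} φ → depth (value φ) ≤ n → H (L ∶ φ) → nf (value φ) ≈ t → Shape L t
    strip n (atom _ _ , _)  _ h (atom _) = atom
    strip n (¬̇ φ , p)       _ h (neg eq) = neg (φ , p) h eq
    strip n (□ φ , p)       _ h (box eq) = box (φ , p) h eq
    strip n (φ →̇ ψ , [ p ]) _ h (imp eq eq′) =
      imp (φ , [ (λ x → p x ∘ inj₁) ]) (ψ , [ (λ x → p x ∘ inj₂) ]) h eq eq′
    strip (suc n) {t} (∀̇ x φ , [ p ]) (s≤s le) h eq = byCases (free? x φ) eq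
      where
      f : Const (Θ ⊕ ℕ) → NF
      f k = tree r r (ρ₀ [ x := r k ]) φ
      byCases : (d : Dec (x FreeIn φ)) → quantify d f (nf φ) ≈ t → Shape L t
      -- The constant `r k` is read through `r` once more; idempotence absorbs this.
      byCases (yes _) (all eq) = all x φ p h λ k → ≈-trans (tree-inst x φ (r k))
        (≈-trans (≈-reflexive (cong (λ k → tree r r (ρ₀ [ x := k ]) φ) (r-idem k))) (eq k))
      byCases (no x∉φ) eq with Instantiated.attained (fulfilled (inj₂ 0) h)
      ... | c , _ , h′ = strip n (inst x φ p c) (≤-trans (≤-reflexive (depth-subst φ)) le) h′
              (≈-trans (tree-inst x φ c) (≈-trans (tree-void x φ x∉φ) eq))

  -- Vacuous for a sentence without a sign in `H`, as constituents left unsigned by an alternative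
  -- require.
  Respects : TV → Sentence (Θ ⊕ ℕ) → Set
  Respects a φ = ∀ {L} → H (L ∶ φ) → a ≡ L

  -- The constant `inj₂ 0` passed to `fulfilled` is a dummy, since only quantified sentences consult
  -- it.
  expanded-¬ : ∀ L φ {a} → H (L ∶ ¬ˢ φ) → Respects a φ → L ∈ ¬̃ a
  expanded-¬ 𝐓 φ h e with here (i ∷ []) ← fulfilled (inj₂ 0) h T¬ with refl ← e i = here refl
  expanded-¬ 𝐭 φ h e with here (i ∷ []) ← fulfilled (inj₂ 0) h t¬ with refl ← e i = here refl
  expanded-¬ 𝐟 φ h e with here (i ∷ []) ← fulfilled (inj₂ 0) h f¬ with refl ← e i = here refl
  expanded-¬ 𝐅 φ h e with here (i ∷ []) ← fulfilled (inj₂ 0) h F¬ with refl ← e i = here refl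

  expanded-□ : ∀ L φ {a} → H (L ∶ □ˢ φ) → Respects a φ → L ∈ □̃₁ a
  expanded-□ 𝐓 φ h e with here (i ∷ []) ← fulfilled (inj₂ 0) h T□ with refl ← e i = here refl
  expanded-□ 𝐭 φ h e with here (i ∷ []) ← fulfilled (inj₂ 0) h t□ with refl ← e i = there (here refl)
  expanded-□ 𝐟 φ h e with fulfilled (inj₂ 0) h f□
  ... | here (i ∷ [])                 with refl ← e i = here refl
  ... | there (here (i ∷ []))         with refl ← e i = here refl
  ... | there (there (here (i ∷ []))) with refl ← e i = here refl
  expanded-□ 𝐅 φ h e with fulfilled (inj₂ 0) h F□
  ... | here (i ∷ [])                 with refl ← e i = there (here refl)
  ... | there (here (i ∷ []))         with refl ← e i = there (here refl)
  ... | there (there (here (i ∷ []))) with refl ← e i = there (here refl)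

  expanded-→ : ∀ L φ ψ {a b} → H (L ∶ (φ →ˢ ψ)) → Respects a φ → Respects b ψ → L ∈ a →̃ b
  expanded-→ 𝐓 φ ψ {a} h e e′ with fulfilled (inj₂ 0) h (T→ {φ = φ} {ψ})
  ... | here (i ∷ [])                                 with refl ← e i = here refl
  ... | there (here (i ∷ j ∷ []))                     with refl ← e i | refl ← e′ j = here refl
  ... | there (there (here (i ∷ j ∷ [])))             with refl ← e i | refl ← e′ j = here refl
  ... | there (there (there (here (i ∷ j ∷ []))))     with refl ← e i | refl ← e′ j = here refl
  -- This alternative signs `ψ` alone, so `a` is arbitrary; every row of the table has `𝐓` in column
  -- `𝐓`.
  ... | there (there (there (there (here (j ∷ []))))) with refl ← e′ j = 𝐓∈→̃𝐓 a
  expanded-→ 𝐭 φ ψ h e e′ with fulfilled (inj₂ 0) h (t→ {φ = φ} {ψ})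
  ... | here (i ∷ j ∷ [])                         with refl ← e i | refl ← e′ j = here refl
  ... | there (here (i ∷ j ∷ []))                 with refl ← e i | refl ← e′ j = there (here refl)
  ... | there (there (here (i ∷ j ∷ [])))         with refl ← e i | refl ← e′ j = there (here refl)
  ... | there (there (there (here (i ∷ j ∷ [])))) with refl ← e i | refl ← e′ j = there (here refl)
  expanded-→ 𝐟 φ ψ h e e′ with fulfilled (inj₂ 0) h (f→ {φ = φ} {ψ})
  ... | here (i ∷ j ∷ [])                 with refl ← e i | refl ← e′ j = here refl
  ... | there (here (i ∷ j ∷ []))         with refl ← e i | refl ← e′ j = here refl
  ... | there (there (here (i ∷ j ∷ []))) with refl ← e i | refl ← e′ j = here refl
  expanded-→ 𝐅 φ ψ h e e′ with fulfilled (inj₂ 0) h (F→ {φ = φ} {ψ})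
  ... | here (i ∷ j ∷ []) with refl ← e i | refl ← e′ j = here refl

  instantiated-∀ : ∀ {L x φ} .{p : Closed (∀̇ x φ)} (g : Const (Θ ⊕ ℕ) → TV) → H (L ∶ ∀ˢ x φ p) →
                   (∀ k → Respects (g k) (inst x φ p (r k))) → ∀̃ᵈ₄ (λ a → ∃[ k ] g k ≡ a) L
  instantiated-∀ {L} {x} {φ} {p} g h e = attained , bounded
    where
    attained : ∃[ k ] g k ≡ L
    attained with Instantiated.attained (fulfilled (inj₂ 0) h)
    ... | c , fc , h′ = c , e c (subst (λ k → H (L ∶ inst x φ p k)) (sym fc) h′)
    bounded : ∀ b → ∃[ k ] g k ≡ b → rank L ≤ rank b
    bounded b (k , refl) with Instantiated.bounded (fulfilled k h)
    ... | inj₁ refl           = z≤n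
    ... | inj₂ (L′ , le , h′) = ≤-trans le (≤-reflexive (cong rank (sym (e k h′))))

  minimum : (g : Const (Θ ⊕ ℕ) → TV) → ∃ (∀̃ᵈ₄ λ a → ∃[ k ] g k ≡ a)
  minimum g with em {∃[ k ] g k ≡ 𝐅} | em {∃[ k ] g k ≡ 𝐟} | em {∃[ k ] g k ≡ 𝐭}
  ... | yes F | _     | _     = 𝐅 , F , λ _ _ → z≤n
  ... | no ¬F | yes f | _     = 𝐟 , f , λ where
    𝐅 F → ⊥-elim (¬F F)
    𝐟 _ → s≤s z≤n
    𝐭 _ → s≤s z≤n
    𝐓 _ → s≤s z≤n
  ... | no ¬F | no ¬f | yes t = 𝐭 , t , λ where
    𝐅 F → ⊥-elim (¬F F)
    𝐟 f → ⊥-elim (¬f f)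
    𝐭 _ → ≤-refl
    𝐓 _ → s≤s (s≤s z≤n)
  ... | no ¬F | no ¬f | no ¬t =
    𝐓 , (inj₂ 0 , only𝐓 (g (inj₂ 0)) refl) , λ { b (k , refl) → ≤-reflexive (cong rank (sym (only𝐓 (g k) refl))) }
    where
    only𝐓 : ∀ a {k} → g k ≡ a → g k ≡ 𝐓
    only𝐓 𝐓 eq = eq
    only𝐓 𝐭 eq = ⊥-elim (¬t (_ , eq))
    only𝐓 𝐟 eq = ⊥-elim (¬f (_ , eq))
    only𝐓 𝐅 eq = ⊥-elim (¬F (_ , eq))

  label : ∀ {t} → Dec (∃[ L ] Labelled L t) → TV → TV
  label (yes (L , _)) _ = L
  label (no _)        a = a

  mutual
    -- The recursion is structural because the branches of `all f` are subtrees, whereas instances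
    -- of a formula are not subformulas.
    val : NF → TV
    val t = label {t} em (default t)

    default : NF → TV
    -- Arbitrary: the structure takes its predicates from the values of atoms.
    default (atom P ks) = 𝐓
    default (neg t)     = proj₁ (some-¬ (val t))
    default (box t)     = proj₁ (some-□ (val t))
    default (all f)     = proj₁ (minimum λ k → val (f k))
    default (imp t u)   = proj₁ (some-→ (val t) (val u))

  val-elim : ∀ t (Q : TV → Set) → (∀ {L} → Labelled L t → Q L) →
             (¬ (∃[ L ] Labelled L t) → Q (default t)) → Q (val t)
  val-elim t Q l d with em {∃[ L ] Labelled L t}
  ... | yes (_ , l′) = l l′
  ... | no ¬l        = d ¬l

  val-labelled : ∀ {L t} → Labelled L t → val t ≡ L
  val-labelled {L} {t} l = val-elim t (_≡ L) (λ l′ → labelled-unique l′ l) (λ ¬l → ⊥-elim (¬l (L , l)))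

  val-respects : ∀ φ {t} → nf (value φ) ≈ t → Respects (val t) φ
  val-respects φ eq h = val-labelled (φ , h , eq)

  val-¬ : ∀ t → val (neg t) ∈ ¬̃ (val t)
  val-¬ t = val-elim (neg t) (_∈ ¬̃ (val t)) (go ∘ labelled-shape) λ _ → proj₂ (some-¬ (val t))
    where
    go : ∀ {L} → Shape L (neg t) → L ∈ ¬̃ (val t)
    go (neg φ h eq) = expanded-¬ _ φ h (val-respects φ eq)

  val-□ : ∀ t → val (box t) ∈ □̃₁ (val t)
  val-□ t = val-elim (box t) (_∈ □̃₁ (val t)) (go ∘ labelled-shape) λ _ → proj₂ (some-□ (val t))
    where
    go : ∀ {L} → Shape L (box t) → L ∈ □̃₁ (val t)
    go (box φ h eq) = expanded-□ _ φ h (val-respects φ eq)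

  val-→ : ∀ t u → val (imp t u) ∈ val t →̃ val u
  val-→ t u = val-elim (imp t u) (_∈ val t →̃ val u) (go ∘ labelled-shape) λ _ → proj₂ (some-→ (val t) (val u))
    where
    go : ∀ {L} → Shape L (imp t u) → L ∈ val t →̃ val u
    go (imp φ ψ h eq eq′) = expanded-→ _ φ ψ h (val-respects φ eq) (val-respects ψ eq′)

  val-∀ : ∀ f → ∀̃ᵈ₄ (λ a → ∃[ k ] val (f k) ≡ a) (val (all f))
  val-∀ f = val-elim (all f) (∀̃ᵈ₄ λ a → ∃[ k ] val (f k) ≡ a) (go ∘ labelled-shape)
              λ _ → proj₂ (minimum λ k → val (f k))
    where
    go : ∀ {L} → Shape L (all f) → ∀̃ᵈ₄ (λ a → ∃[ k ] val (f k) ≡ a) L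
    go (all x φ p h eq) = instantiated-∀ (λ k → val (f k)) h λ k → val-respects (inst x φ p (r k)) (eq k)

  -- Labels transfer along `≈`, so either both trees are labelled, and alike, or both take their
  -- defaults.
  val-cong     : ∀ {t u} → t ≈ u → val t ≡ val u
  default-cong : ∀ {t u} → t ≈ u → default t ≡ default u
  val-cong {t} {u} t≈u = val-elim t (_≡ val u) (λ l → sym (val-labelled (labelled-≈ t≈u l))) λ ¬l →
    val-elim u (default t ≡_) (λ l → ⊥-elim (¬l (_ , labelled-≈ (≈-sym t≈u) l))) λ _ → default-cong t≈u
  default-cong (atom _)  = refl
  default-cong (neg p)   = cong (proj₁ ∘ some-¬) (val-cong p)
  default-cong (box p)   = cong (proj₁ ∘ some-□) (val-cong p)
  default-cong (all {f} {g} p) =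
    -- The two branching functions agree only pointwise, so the chosen minima are compared by
    -- uniqueness.
    ∀̃-unique (proj₂ (minimum λ k → val (f k)))
      (∀̃-cong (λ (k , eq) → k , trans (val-cong (p k)) eq)
              (λ (k , eq) → k , trans (sym (val-cong (p k))) eq)
              (proj₂ (minimum λ k → val (g k))))
  default-cong (imp p q) = cong₂ (λ a b → proj₁ (some-→ a b)) (val-cong p) (val-cong q)

  -- A term model on all constants. Predicates see their arguments through `r`, so an element is
  -- indistinguishable from its image under `r`.
  𝔄 : Structure Θ
  𝔄 = record
    { Universe    = Const (Θ ⊕ ℕ)
    ; someElement = inj₂ 0
    ; ⟦_⟧ᵖ        = λ P ks → val (atom P (Vec.map r ks))
    ; ⟦_⟧ᶜ        = inj₁ }

  -- No constant of `Θ` denotes `inj₂ n`, so that element has a constant of its own. Hence instances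
  -- exhaust the branches over the universe.
  interpret-onto : ∀ k → ∃[ c ] interpret 𝔄 c ≡ k
  interpret-onto (inj₁ c) = inj₁ c , refl
  interpret-onto (inj₂ n) = inj₂ (inj₂ n , [ (λ { (c , ()) }) ]) , refl

  nfᵁ : Formula (Θ ⊕U 𝔄) → NF
  nfᵁ = tree (r ∘ interpret 𝔄) r ρ₀

  v : Sentence (Θ ⊕U 𝔄) → TV
  v φ = val (nfᵁ (value φ))

  v-∀ : ∀ x φ .(p : Closed (∀̇ x φ)) → ∀̃ᵈ₄ (λ a → ∃[ c ] v (inst x φ p c) ≡ a) (v (∀ˢ x φ p))
  v-∀ x φ p = byCases (free? x φ)
    where
    f : Const (Θ ⊕ ℕ) → NF
    f k = tree (r ∘ interpret 𝔄) r (ρ₀ [ x := r k ]) φ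
    v-inst : ∀ c → v (inst x φ p c) ≡ val (f (interpret 𝔄 c))
    v-inst c = val-cong (tree-inst x φ c)
    byCases : (d : Dec (x FreeIn φ)) →
              ∀̃ᵈ₄ (λ a → ∃[ c ] v (inst x φ p c) ≡ a) (val (quantify d f (nfᵁ φ)))
    byCases (yes _) = ∀̃-cong
      (λ (k , eq) → let (c , c≡k) = interpret-onto k in
         c , trans (v-inst c) (trans (cong (λ k → val (f k)) c≡k) eq))
      (λ (c , eq) → interpret 𝔄 c , trans (sym (v-inst c)) eq)
      (val-∀ f)
    byCases (no x∉φ) = ∀̃-cong
      (λ eq → let (c , _) = interpret-onto (inj₂ 0) in c , trans (v-void c) eq)
      (λ (c , eq) → trans (sym (v-void c)) eq)
      (∀̃-singleton (val (nfᵁ φ)))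
      where
      v-void : ∀ c → v (inst x φ p c) ≡ val (nfᵁ φ)
      v-void c = trans (v-inst c) (val-cong (tree-void x φ x∉φ))

  v-valuation : IsTm*Valuation 𝔄 v
  v-valuation = record
    { v-atom    = λ P cs → cong (λ ks → val (atom P ks))
                    (trans (sym (Vec.map-∘ _ con cs)) (Vec.map-∘ r (interpret 𝔄) cs))
    ; v-¬       = λ φ → val-¬ (nfᵁ (value φ))
    ; v-□       = λ φ → val-□ (nfᵁ (value φ))
    ; v-→       = λ φ ψ → val-→ (nfᵁ (value φ)) (nfᵁ (value ψ))
    ; v-∀       = v-∀
    ; v-variant = λ φ φ′ p → val-cong (∼⇒≈ p ρ₀) }

  -- Both liftings, to the signature of the tableau and to that of the structure, read `c` as
  -- `r (inj₁ c)` and so share a normal form.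
  v-lift : ∀ {L} (φ : Sentence Θ) → H (L ∶ liftˢ φ) → v (liftˢ φ) ≡ L
  v-lift φ h = val-labelled (liftˢ φ , h , ≈-trans (tree-lift (value φ)) (≈-sym (tree-lift (value φ))))

-- Chains of implications and closed instances

v-foldr : ∀ {Θ} {𝔄 : Structure Θ} {v} → IsTm*Valuation 𝔄 v → (Γ : List (Sentence Θ)) (φ : Sentence Θ) →
          Undesignated (v (liftˢ (foldr _→ˢ_ φ Γ))) →
          All (λ γ → Designated (v (liftˢ γ))) Γ × Undesignated (v (liftˢ φ))
v-foldr V []      φ u = [] , u
v-foldr V (γ ∷ Γ) φ u with undesignated-→ _ _ (IsTm*Valuation.v-→ V (liftˢ γ) (liftˢ (foldr _→ˢ_ φ Γ))) u
... | dγ , u′ with v-foldr V Γ φ u′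
...   | dΓ , uφ = dγ ∷ dΓ , uφ

close-lift : ∀ {Θ : Signature} {X} (φ : Sentence Θ) (ρ : Var → Const (Θ ⊕ X)) → close ρ (lift (value φ)) ≡ liftˢ φ
close-lift (φ , [ p ]) ρ = value-injective
  (subst-closed (lift φ) λ x i → recompute-closed φ p x (free-lift⁻ φ i))

-- Consequence demands a constant for every variable even when the formula is closed; some element
-- is either named in `Θ` or has its own new constant.
someConst : ExcludedMiddle 0ℓ → {Θ : Signature} (𝔄 : Structure Θ) → Const (Θ ⊕U 𝔄)
someConst em 𝔄 with em {∃[ c ] Structure.⟦ 𝔄 ⟧ᶜ c ≡ Structure.someElement 𝔄}
... | yes (c , _) = inj₁ c
... | no ¬named   = inj₂ (Structure.someElement 𝔄 , [ ¬named ])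

-- Used constants

module Retraction (em : ExcludedMiddle 0ℓ) {Θ : Signature} (D : List (Const (Θ ⊕ ℕ))) where

  -- Θ may have uncountably many constants, but a fair construction can only
  -- instantiate countably many: those in D and the new ones.
  retract : Const (Θ ⊕ ℕ) → Const (Θ ⊕ ℕ)
  retract (inj₂ n) = inj₂ n
  retract (inj₁ c) with em {inj₁ c ∈ D}
  ... | yes _ = inj₁ c
  ... | no _  = inj₂ 0

  retract-∈ : ∀ {k} → k ∈ D → retract k ≡ k
  retract-∈ {inj₂ n} i = refl
  retract-∈ {inj₁ c} i with em {inj₁ c ∈ D}
  ... | yes _ = refl
  ... | no ¬i = ⊥-elim (¬i i)

  retract-image : ∀ k → retract k ∈ D ⊎ (∃[ n ] retract k ≡ inj₂ n)
  retract-image (inj₂ n) = inj₂ (n , refl)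
  retract-image (inj₁ c) with em {inj₁ c ∈ D}
  ... | yes i = inj₁ i
  ... | no _  = inj₂ (0 , refl)

  retract-idem : ∀ k → retract (retract k) ≡ retract k
  retract-idem k with retract-image k
  ... | inj₁ i        = retract-∈ i
  ... | inj₂ (n , eq) = trans (cong retract eq) (sym eq)

  enumerate : List (Const (Θ ⊕ ℕ)) → ℕ → Const (Θ ⊕ ℕ)
  enumerate []      n       = inj₂ n
  enumerate (d ∷ E) zero    = d
  enumerate (d ∷ E) (suc n) = enumerate E n

  enumerate-∈ : ∀ {E k} → k ∈ E → ∃[ j ] enumerate E j ≡ k
  enumerate-∈ (here refl) = 0 , refl
  enumerate-∈ (there i)   = let (j , eq) = enumerate-∈ i in suc j , eq

  enumerate-new : ∀ E n → ∃[ j ] enumerate E j ≡ inj₂ n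
  enumerate-new []      n = n , refl
  enumerate-new (d ∷ E) n = let (j , eq) = enumerate-new E n in suc j , eq

  -- Only values of `retract` have to be hit, and these lie in `D` or are new, which leaves
  -- countably many.
  enumerate-onto : ∀ k → ∃[ j ] retract (enumerate D j) ≡ retract k
  enumerate-onto k with retract-image k
  ... | inj₁ i        = let (j , eq) = enumerate-∈ i in j , trans (cong retract eq) (retract-idem k)
  ... | inj₂ (n , eq) = let (j , eq′) = enumerate-new D n in j , trans (cong retract eq′) (sym eq)

-- Completeness

unclosable⇒counterexample : ExcludedMiddle 0ℓ → ∀ {Θ : Signature} {L} (χ : Sentence Θ) →
  ¬ Closable (root (L ∶ liftˢ χ)) →
  Σ[ 𝔄 ∈ Structure Θ ] Σ[ v ∈ (Sentence (Θ ⊕U 𝔄) → TV) ] IsTm*Valuation 𝔄 v × v (liftˢ χ) ≡ L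
unclosable⇒counterexample em {Θ} {L} χ unclosable = 𝔄 , v , v-valuation , v-lift χ (0 , here refl)
  where
  open Retraction em {Θ} (constants (lift (value χ)))
  open Search em {Θ} retract (λ _ → refl) retract-idem (enumerate (constants (lift (value χ)))) enumerate-onto
  root-extendable : Extendable (root (L ∶ liftˢ χ))
  root-extendable = record
    { unclosable = unclosable
    ; fixed      = λ { (here refl) k i → retract-∈ (occurs⇒∈constants (lift (value χ)) i) }
    ; witnessed  = λ () }
  open Model em {Θ} retract (λ _ → refl) retract-idem (Reached root-extendable) (reached-hintikka root-extendable)

mainTheorem4 : ExcludedMiddle 0ℓ →
    (Θ : Signature) (Γ : List (Sentence Θ)) (φ : Sentence Θ) →
    map value Γ ⊨Tm* value φ → Γ ⊨𝒯Tm* φ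
mainTheorem4 em Θ Γ φ valid L u with em {Closable (root (L ∶ liftˢ (foldr _→ˢ_ φ Γ)))}
... | yes closable = closable
... | no unclosable with unclosable⇒counterexample em (foldr _→ˢ_ φ Γ) unclosable
-- In the counterexample the whole chain has the undesignated value `L`, so all premises are
-- designated while `φ` is not, against validity.
...   | 𝔄 , v , V , refl = ⊥-elim (undesignated⇒¬designated (proj₂ values)
          (subst (Designated ∘ v) (close-lift φ ρ) (valid 𝔄 v V premises ρ)))
  where
  values : All (λ γ → Designated (v (liftˢ γ))) Γ × Undesignated (v (liftˢ φ))
  values = v-foldr V Γ φ u
  ρ : Var → Const (Θ ⊕U 𝔄)
  ρ _ = someConst em 𝔄
  premises : ∀ γ → γ ∈ map value Γ → ∀ (ρ : Var → Const (Θ ⊕U 𝔄)) → Designated (v (close ρ (lift γ)))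
  premises γ i ρ with List∈.∈-map⁻ value i
  ... | γ′ , j , refl = subst (Designated ∘ v) (sym (close-lift γ′ ρ)) (All.lookup (proj₁ values) j)
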